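{- Let $n\ge3$, let $\mathbb T$ be a triangulation of an $n$-gon with quiddity $(c_u)_{u\in\mathbb Z}$, let $i\in\mathbb Z$, and let $\theta_{i,j+1}=\dfrac{r_{i,j+1}}{s_{i,j+1}}$ $(i-1\le j\le i+n-2)$ be the labels in the $q$-Farey labeling of $(\mathbb T,i)$. (1) For the numerators $r_{i,j+1}$ with $i-1\le j\le i+n-3$, $$\deg_{\min}r_{i,j+1}=\nu^{\mathrm{tri}}_{i-1,j}-\nu^{\mathrm{tri}}_{i,j}=\nu^{\mathrm{md}}_{i-1,j},$$ $$\deg r_{i,j+1}=\sum_{u=i}^{j}(c_u-1)-\nu^{\mathrm{tri}}_{i,j+1}-\nu^{\mathrm{tri}}_{i,j}=\nu^{\mathrm{md}}_{i-1,j}+\nu^{\mathrm{rec}}_{i,j,i+n-2}.$$ In particular, for $j=i+n-2$, $r_{i,i+n-1}=0$. (2) For the denominators $s_{i,j+1}$ with $i\le j\le i+n-2$, $$\deg_{\min}s_{i,j+1}=0,$$ $$\deg s_{i,j+1}=\sum_{u=i+1}^{j}(c_u-1)-\nu^{\mathrm{tri}}_{i+1,j+1}-\nu^{\mathrm{tri}}_{i,j}=\nu^{\mathrm{rec}}_{i+1,j,i+n-1}.$$ In particular, for $j=i-1$, $s_{i,i}=0$.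
   Context: Triangulations. Let $n\ge3$ and let $\mathcal P$ be a convex $n$-gon with vertices numbered clockwise $v_0,\dots,v_{n-1}$; indices are extended to $\mathbb Z$ by $v_{u+n}=v_u$. A triangulation $\mathbb T$ of $\mathcal P$ is by $n-3$ non-crossing diagonals; its triangles are called cells. Let $c_u$ be the number of cells having $v_u$ as a vertex; the $n$-periodic sequence $(c_u)_{u\in\mathbb Z}$ is the quiddity of $\mathbb T$. $q$-Farey labeling of $(\mathbb T,i)$. The base edge is $v_{i-1}v_i=v_{i+n-1}v_i$. Represent vertices by indices in $\{i,\dots,i+n-1\}$. Each cell is then uniquely $\{v_a,v_b,v_g\}$ with $i\le b<g<a\le i+n-1$ (clockwise order $v_a,v_b,v_g$); its base side is $v_av_b$ (the base edge itself for the cell containing the base edge; otherwise the side separating the cell from the base edge). Assign weights to sides and pairs $(r_{i,j},s_{i,j})\in\mathbb Z[q]^2$, $i\le j\le i+n-1$, to vertices, starting from the base edge and proceeding from each cell to its neighbours away from the base edge: the base edge has weight $q^{ -1}$, $(r_{i,i+n-1},s_{i,i+n-1})=(0,1)$, $(r_{i,i},s_{i,i})=(1,0)$; if a cell with indices $b<g<a$ has base side $v_av_b$ of weight $q^{\ell-1}$, then $r_{i,g}=r_{i,a}+q^{\ell}r_{i,b}$, $s_{i,g}=s_{i,a}+q^{\ell}s_{i,b}$, the side $v_gv_a$ gets weight $1$ and the side $v_bv_g$ gets weight $q^\ell$. The label of $v_j$ is $\theta_{i,j}=r_{i,j}/s_{i,j}$ (fractions not reduced). Conway--Coxeter frieze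 of $\mathbb T$: the array of integers $\sigma_{k,\ell}$, $0\le\ell-k\le n+1$, determined by $\sigma_{k,k}=0$, $\sigma_{k,k+1}=1$, $\sigma_{k,k+2}=c_{k+1}$ and, recursively for $\ell-k\ge3$, $\sigma_{k,\ell-1}\sigma_{k+1,\ell}-\sigma_{k+1,\ell-1}\sigma_{k,\ell}=1$ (well defined in this range). Numbers of occurrences of $1$ (each is $0$ when the index set is empty; in particular $\nu^{\mathrm{tri}}_{i,i-1}=0$): $\nu^{\mathrm{tri}}_{k,\ell}=\#\{(a,b): k\le a,\ a+2\le b\le\ell,\ \sigma_{a,b}=1\}$; $\nu^{\mathrm{md}}_{k,\ell}=\#\{b: k+2\le b\le\ell,\ \sigma_{k,b}=1\}$; $\nu^{\mathrm{rec}}_{k,u,\ell}=\#\{(a,b): k\le a\le u,\ u+2\le b\le\ell,\ \sigma_{a,b}=1\}$. Empty sums are $0$. For a nonzero polynomial $f\in\mathbb Z[q]$, $\deg_{\min}f$ and $\deg f$ are the smallest and largest exponents of $q$ occurring in $f$. -}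

module Defs where

open import Data.Nat as ℕ using (ℕ; suc; NonZero)
import Data.Nat.DivMod as ℕ
open import Data.Integer
  using (ℤ; +_; 0ℤ; 1ℤ; -1ℤ; _+_; _-_; _*_; _⊔_; ∣_∣; _≤_; _<_; _≤?_; _≟_)
open import Data.Integer.DivMod using (_%ℕ_; n%ℕd<d)
open import Data.Fin as Fin using (Fin; toℕ; fromℕ<)
import Data.Fin.Properties as Fin
open import Data.List
  using (List; []; _∷_; _++_; map; foldr; filter; length; upTo; allFin;
         cartesianProduct; replicate)
open import Data.List.Membership.Propositional using (_∈_)
open import Data.List.Relation.Unary.All using (All)
open import Data.List.Relation.Unary.Unique.Propositional using (Unique)
import Data.List.Membership.DecPropositional as DecMembership
open import Data.Product using (_×_; _,_)
open import Data.Product.Properties using (≡-dec)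
open import Data.Sum using (_⊎_)
open import Relation.Nullary using (¬_; Dec; _×-dec_; _⊎-dec_)
open import Relation.Binary.PropositionalEquality using (_≡_; _≢_)

-- ℤ[q]: f₀ ∷ f₁ ∷ … is f₀ + f₁ q + …; trailing zeros are allowed, so
-- polynomials are compared by _≈_ (equal coefficients), not by _≡_.

Poly : Set
Poly = List ℤ

coeff : Poly → ℕ → ℤ
coeff []      _       = 0ℤ
coeff (x ∷ f) 0       = x
coeff (x ∷ f) (suc d) = coeff f d

infix 4 _≈_
_≈_ : Poly → Poly → Set
f ≈ g = ∀ d → coeff f d ≡ coeff g d

0ᵖ 1ᵖ : Poly
0ᵖ = []
1ᵖ = 1ℤ ∷ []

infixl 6 _⊕_
_⊕_ : Poly → Poly → Poly
[]      ⊕ g       = g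
(x ∷ f) ⊕ []      = x ∷ f
(x ∷ f) ⊕ (y ∷ g) = (x + y) ∷ (f ⊕ g)

infixr 7 q^_·_
q^_·_ : ℕ → Poly → Poly
q^ d · f = replicate d 0ℤ ++ f

-- Both relations force f to be nonzero.

IsDegMin : Poly → ℕ → Set
IsDegMin f d = coeff f d ≢ 0ℤ × (∀ e → coeff f e ≢ 0ℤ → d ℕ.≤ e)

IsDeg : Poly → ℕ → Set
IsDeg f d = coeff f d ≢ 0ℤ × (∀ e → coeff f e ≢ 0ℤ → e ℕ.≤ d)

-- The integers k, k+1, …, ℓ; empty if ℓ < k.

range : ℤ → ℤ → List ℤ
range k ℓ = map (λ t → k + + t) (upTo ∣ 0ℤ ⊔ (ℓ - k + 1ℤ) ∣)

sumFromTo : ℤ → ℤ → (ℤ → ℤ) → ℤ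
sumFromTo k ℓ f = foldr _+_ 0ℤ (map f (range k ℓ))

module _ {n : ℕ} .{{_ : NonZero n}} where

  Side : Fin n → Fin n → Set
  Side x y = toℕ y ≡ suc (toℕ x) ℕ.% n ⊎ toℕ x ≡ suc (toℕ y) ℕ.% n

  IsDiagonal : Fin n × Fin n → Set
  IsDiagonal (x , y) = x Fin.< y × ¬ Side x y

  Cross : Fin n × Fin n → Fin n × Fin n → Set
  Cross (x , y) (z , t) =
    (x Fin.< z × z Fin.< y × y Fin.< t) ⊎ (z Fin.< x × x Fin.< t × t Fin.< y)

-- The convex n-gon enters only through the cyclic order of its vertices,
-- which are Fin n.

record Triangulation (n : ℕ) .{{_ : NonZero n}} : Set where
  field
    diagonals   : List (Fin n × Fin n)
    areDiagonal : All IsDiagonal diagonals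
    distinct    : Unique diagonals
    nonCrossing : ∀ {d e} → d ∈ diagonals → e ∈ diagonals → ¬ Cross d e
    number      : length diagonals ≡ n ℕ.∸ 3

module _ {n : ℕ} .{{_ : NonZero n}} where

  v : ℤ → Fin n
  v u = fromℕ< (n%ℕd<d u n)

  module _ (T : Triangulation n) where
    open Triangulation T
    open DecMembership (≡-dec (Fin._≟_ {n}) (Fin._≟_ {n})) using (_∈?_)

    Edge : Fin n → Fin n → Set
    Edge x y = Side x y ⊎ (x , y) ∈ diagonals ⊎ (y , x) ∈ diagonals

    -- All polygon vertices lie on the boundary, so three vertices joined
    -- pairwise by sides or chosen diagonals span a triangle that no other
    -- chosen diagonal enters, i.e. a cell.
    Cell : Fin n → Fin n → Fin n → Set
    Cell x y z = Edge x y × Edge y z × Edge x z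

    edge? : ∀ x y → Dec (Edge x y)
    edge? x y =
      (toℕ y ℕ.≟ suc (toℕ x) ℕ.% n ⊎-dec toℕ x ℕ.≟ suc (toℕ y) ℕ.% n)
      ⊎-dec ((x , y) ∈? diagonals ⊎-dec (y , x) ∈? diagonals)

    cell? : ∀ x y z → Dec (Cell x y z)
    cell? x y z = edge? x y ×-dec edge? y z ×-dec edge? x z

    cells : List (Fin n × Fin n × Fin n)
    cells = filter
      (λ (x , y , z) → x Fin.<? y ×-dec y Fin.<? z ×-dec cell? x y z)
      (cartesianProduct (allFin n) (cartesianProduct (allFin n) (allFin n)))

    quiddity : ℤ → ℕ
    quiddity u = length (filter
      (λ (x , y , z) → v u Fin.≟ x ⊎-dec v u Fin.≟ y ⊎-dec v u Fin.≟ z) cells)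

-- The weight of the side v_b v_a is q^(w b a), with w b a = -1 allowed.
-- Values of r, s outside the indices i, …, i+n-1, and of w on pairs that
-- are not sides of cells, are left arbitrary.

record FareyLabeling {n : ℕ} .{{_ : NonZero n}} (T : Triangulation n) (i : ℤ) : Set where
  last : ℤ
  last = i + + n - 1ℤ
  field
    r s      : ℤ → Poly
    w        : ℤ → ℤ → ℤ
    w-base   : w i last ≡ -1ℤ
    r-last   : r last ≈ 0ᵖ
    s-last   : s last ≈ 1ᵖ
    r-first  : r i ≈ 1ᵖ
    s-first  : s i ≈ 0ᵖ
    cellRule : ∀ {b g a : ℤ} {ℓ : ℕ} →
      i ≤ b → b < g → g < a → a ≤ last →
      Cell T (v b) (v g) (v a) →
      w b a ≡ + ℓ - 1ℤ →
      r g ≈ r a ⊕ q^ ℓ · r b ×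
      s g ≈ s a ⊕ q^ ℓ · s b ×
      w g a ≡ 0ℤ ×
      w b g ≡ + ℓ

-- Values of σ k ℓ outside 0 ≤ ℓ - k ≤ n + 1 are left arbitrary.

record Frieze {n : ℕ} .{{_ : NonZero n}} (T : Triangulation n) : Set where
  field
    σ     : ℤ → ℤ → ℤ
    row0  : ∀ k → σ k k ≡ 0ℤ
    row1  : ∀ k → σ k (k + 1ℤ) ≡ 1ℤ
    row2  : ∀ k → σ k (k + + 2) ≡ + quiddity T (k + 1ℤ)
    unimodular : ∀ k ℓ → + 3 ≤ ℓ - k → ℓ - k ≤ + n + 1ℤ →
      σ k (ℓ - 1ℤ) * σ (k + 1ℤ) ℓ - σ (k + 1ℤ) (ℓ - 1ℤ) * σ k ℓ ≡ 1ℤ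

module _ (σ : ℤ → ℤ → ℤ) where

  -- The conditions k ≤ a and a + 2 ≤ b ≤ ℓ put both a and b in k, …, ℓ.
  νtri : ℤ → ℤ → ℕ
  νtri k ℓ = length (filter
    (λ (a , b) → a + + 2 ≤? b ×-dec σ a b ≟ 1ℤ)
    (cartesianProduct (range k ℓ) (range k ℓ)))

  νmd : ℤ → ℤ → ℕ
  νmd k ℓ = length (filter (λ b → σ k b ≟ 1ℤ) (range (k + + 2) ℓ))

  νrec : ℤ → ℤ → ℤ → ℕ
  νrec k u ℓ = length (filter
    (λ (a , b) → σ a b ≟ 1ℤ)
    (cartesianProduct (range k u) (range (u + + 2) ℓ)))

{-# OPTIONS --safe #-}

-- Seen from the base edge v_i v_{i+n-1}, the triangulation is a binary tree whose
-- nodes are the cells (b , g , a); it exists because n - 3 non-crossing diagonals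
-- leave no room for a larger face. Descending this tree, a base side v_b v_a
-- other than the base edge has weight q^w, where w is the number of diagonals
-- from v_b to vertices strictly beyond v_a. In r_g = r_a + q^ℓ r_b and
-- s_g = s_a + q^ℓ s_b the degrees of the two summands always differ, so the
-- extreme coefficients stay 1 and the degrees can be read off: deg s_g counts the
-- diagonals over v_g that avoid v_i, deg r_g all diagonals over v_g, and deg_min
-- r_g the diagonals over v_g that end at v_{i+n-1}.
--
-- These counts become those of the statement once σ_{a,b} = 1 is known to mean
-- that v_a v_b is a diagonal (2 ≤ b - a ≤ n - 2). The recurrence
-- x_{ℓ+1} = c_ℓ x_ℓ - x_{ℓ-1} makes x_g = x_a + x_b on every cell (eliminate the
-- vertices under a side one cell at a time), so its solution with initial values
-- 0, 1 is positive, is 1 exactly at the neighbours of its base vertex, and is the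
-- frieze by unimodularity. As c_u - 1 is the number of diagonals at v_u, the
-- formulas with Σ (c_u - 1) count the ends of diagonals in two ways.

module Submission where

open import Defs
open import Data.Bool using (if_then_else_; true; false)
open import Data.Empty using (⊥; ⊥-elim)
open import Data.Fin as Fin using (Fin; toℕ)
import Data.Fin.Properties as Fin
import Data.Integer as ℤ
import Data.Integer.Properties as ℤ
import Data.Integer.Tactic.RingSolver as ℤ
open import Data.Integer.DivMod using (_%ℕ_; _/ℕ_; n%ℕd<d; a≡a%ℕn+[a/ℕn]*n)
open import Data.List using (List; []; _∷_; length; filter; map; foldr; upTo; applyUpTo; allFin; cartesianProduct)
open import Data.List.Properties using (length-map; length-++; filter-++; filter-all; filter-none)
open import Data.List.Membership.Propositional using (_∈_)
open import Data.List.Membership.Propositional.Properties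
  using (∈-filter⁻; ∈-filter⁺; ∈-map⁺; ∈-map⁻; ∈-allFin; ∈-cartesianProduct⁺; ∈-upTo⁺; ∈-upTo⁻)
open import Data.List.Membership.Propositional.Properties.WithK using (unique∧set⇒bag)
import Data.List.Membership.DecPropositional as DecMembership
open import Data.List.Relation.Binary.BagAndSetEquality using (∼bag⇒↭)
open import Data.List.Relation.Binary.Permutation.Propositional.Properties using (↭-length)
open import Data.List.Relation.Unary.All as All using (All; []; _∷_)
open import Data.List.Relation.Unary.AllPairs using ([]; _∷_)
open import Data.List.Relation.Unary.Any using (here; there)
open import Data.List.Relation.Unary.Unique.Propositional using (Unique)
import Data.List.Relation.Unary.Unique.Propositional.Properties as Unique
open import Data.Nat as ℕ using (ℕ; zero; suc; z≤n; s≤s; s≤s⁻¹; NonZero)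
open import Data.Nat.DivMod
  using (_%_; _/_; m≡m%n+[m/n]*n; m%n<n; m%n%n≡m%n; m<n⇒m%n≡m; m*n%n≡0; n%n≡0; [m+n]%n≡m%n; [m+kn]%n≡m%n; %-distribˡ-+)
import Data.Nat.Properties as ℕ
import Data.Nat.Tactic.RingSolver as ℕ
open import Data.Product using (_×_; _,_; proj₁; proj₂; ∃-syntax)
open import Data.Product.Properties using (≡-dec; ,-injective)
open import Data.Sum as Sum using (_⊎_; inj₁; inj₂; swap)
open import Data.Unit using (⊤; tt)
open import Function using (_∘_; mk⇔)
open import Relation.Nullary using (Dec; does; yes; no; ¬_; _×-dec_; _⊎-dec_)
open import Relation.Nullary.Decidable using (dec-true; dec-false)
open import Relation.Unary using (Decidable)
open import Relation.Binary.PropositionalEquality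

-- Labels need the cells as seen from one base edge only, but row k of the frieze is governed by the
-- cells seen from v_k, for every k. The number of diagonals can be exploited only after cutting the
-- polygon open: between b and a there is room for at most a - b - 1 noncrossing pairs, (b , a)
-- included, and the n - 3 diagonals together with the base edge attain this bound on 0, ..., N. So
-- the tree is built for the single cut at v_0 and its cells are carried to the other base edges by
-- unrolling the vertices to natural positions: an edge that wraps around the cut is a chord seen
-- from its other side, and its apex belongs to the cell above that chord instead of the one below.
-- `Window` hides this, and one induction along the tree then serves labels and frieze alike.
-- Positivity must precede the identification with the frieze, since the unimodular rule gives
-- `σ k ℓ` only after division by an entry of the next row. Polygon sides are the recurring
-- exception: their frieze entries are 1 although they are not diagonals, and bounds on indices keep
-- them out of the counts.

-- Finite sums over half-open ranges of natural numbers

module Sums where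
  open import Data.Nat using (_+_; _∸_; _<_; _≤_)
  open import Data.Nat.Properties

  ∑< : ℕ → (ℕ → ℕ) → ℕ
  ∑< zero    f = 0
  ∑< (suc m) f = f 0 + ∑< m (f ∘ suc)

  opaque
    ∑ : ℕ → ℕ → (ℕ → ℕ) → ℕ
    ∑ lo hi f = ∑< (hi ∸ lo) (λ t → f (lo + t))

    ∑-def : ∀ lo hi f → ∑ lo hi f ≡ ∑< (hi ∸ lo) (λ t → f (lo + t))
    ∑-def lo hi f = refl

  ∑<-cong : ∀ m {f g} → (∀ {t} → t < m → f t ≡ g t) → ∑< m f ≡ ∑< m g
  ∑<-cong zero    f≗g = refl
  ∑<-cong (suc m) f≗g = cong₂ _+_ (f≗g (s≤s z≤n)) (∑<-cong m (f≗g ∘ s≤s))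

  ∑<-mono : ∀ m {f g} → (∀ {t} → t < m → f t ≤ g t) → ∑< m f ≤ ∑< m g
  ∑<-mono zero    f≤g = z≤n
  ∑<-mono (suc m) f≤g = +-mono-≤ (f≤g (s≤s z≤n)) (∑<-mono m (f≤g ∘ s≤s))

  ∑<-zero : ∀ m → ∑< m (λ _ → 0) ≡ 0
  ∑<-zero zero    = refl
  ∑<-zero (suc m) = ∑<-zero m

  ∑<-+ : ∀ m f g → ∑< m (λ t → f t + g t) ≡ ∑< m f + ∑< m g
  ∑<-+ zero    f g = refl
  ∑<-+ (suc m) f g = trans (cong (f 0 + g 0 +_) (∑<-+ m (f ∘ suc) (g ∘ suc)))
    (interchange (f 0) (g 0) _ _)
    where
    interchange : ∀ a b c d → a + b + (c + d) ≡ a + c + (b + d)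
    interchange = ℕ.solve-∀

  ∑<-split : ∀ m p f → ∑< (m + p) f ≡ ∑< m f + ∑< p (λ t → f (m + t))
  ∑<-split zero    p f = refl
  ∑<-split (suc m) p f =
    trans (cong (f 0 +_) (∑<-split m p (f ∘ suc))) (sym (+-assoc (f 0) _ _))

  ∑<-bound : ∀ {lo hi t} → t < hi ∸ lo → lo + t < hi
  ∑<-bound {lo} {hi} {t} t< = subst (lo + t <_)
    (m+[n∸m]≡n {lo} (<⇒≤ (≰⇒> λ hi≤lo → n≮0 (subst (t <_) (m≤n⇒m∸n≡0 {hi} hi≤lo) t<))))
    (+-monoʳ-< lo {t} t<)

  opaque
    unfolding ∑

    ∑-cong : ∀ {lo hi f g} → (∀ {t} → lo ≤ t → t < hi → f t ≡ g t) → ∑ lo hi f ≡ ∑ lo hi g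
    ∑-cong {lo} {hi} f≗g = ∑<-cong (hi ∸ lo) λ t< → f≗g (m≤m+n lo _) (∑<-bound t<)

    ∑-mono : ∀ {lo hi f g} → (∀ {t} → lo ≤ t → t < hi → f t ≤ g t) → ∑ lo hi f ≤ ∑ lo hi g
    ∑-mono {lo} {hi} f≤g = ∑<-mono (hi ∸ lo) λ t< → f≤g (m≤m+n lo _) (∑<-bound t<)

    ∑-zero : ∀ {lo hi f} → (∀ {t} → lo ≤ t → t < hi → f t ≡ 0) → ∑ lo hi f ≡ 0
    ∑-zero {lo} {hi} f≗0 = trans (∑-cong f≗0) (∑<-zero (hi ∸ lo))

    ∑-+ : ∀ lo hi f g → ∑ lo hi (λ t → f t + g t) ≡ ∑ lo hi f + ∑ lo hi g
    ∑-+ lo hi f g = ∑<-+ (hi ∸ lo) _ _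

    ∑-empty : ∀ lo f → ∑ lo lo f ≡ 0
    ∑-empty lo f rewrite n∸n≡0 lo = refl

    ∑-single : ∀ lo f → ∑ lo (suc lo) f ≡ f lo
    ∑-single lo f rewrite m+n∸n≡m 1 lo | +-identityʳ lo = +-identityʳ _

    ∑-split : ∀ {lo mid hi} f → lo ≤ mid → mid ≤ hi → ∑ lo hi f ≡ ∑ lo mid f + ∑ mid hi f
    ∑-split {lo} f lo≤mid mid≤hi
      with p , refl ← m≤n⇒∃[o]m+o≡n lo≤mid
      with q , refl ← m≤n⇒∃[o]m+o≡n mid≤hi
      rewrite m+n∸m≡n lo p | m+n∸m≡n (lo + p) q | +-assoc lo p q | m+n∸m≡n lo (p + q)
      = trans (∑<-split p q _) (cong (∑< p _ +_) (∑<-cong q λ _ → cong f (sym (+-assoc lo p _))))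

  ∑-first : ∀ {lo hi} f → lo < hi → ∑ lo hi f ≡ f lo + ∑ (suc lo) hi f
  ∑-first {lo} f lo<hi = trans (∑-split f (n≤1+n lo) lo<hi) (cong (_+ ∑ (suc lo) _ f) (∑-single lo f))

  ∑-last : ∀ {lo hi} f → lo ≤ hi → ∑ lo (suc hi) f ≡ ∑ lo hi f + f hi
  ∑-last {hi = hi} f lo≤hi = trans (∑-split f lo≤hi (n≤1+n hi)) (cong (∑ _ hi f +_) (∑-single hi f))

  ind : {P : Set} → Dec P → ℕ
  ind P? = if does P? then 1 else 0

  module _ {P : Set} (P? : Dec P) where

    ind-yes : P → ind P? ≡ 1
    ind-yes p = cong (λ b → if b then 1 else 0) (dec-true P? p)

    ind-no : ¬ P → ind P? ≡ 0
    ind-no ¬p = cong (λ b → if b then 1 else 0) (dec-false P? ¬p)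

  ind-cong : {P Q : Set} (P? : Dec P) (Q? : Dec Q) → (P → Q) → (Q → P) → ind P? ≡ ind Q?
  ind-cong P? (yes q) _   Q⇒P = ind-yes P? (Q⇒P q)
  ind-cong P? (no ¬q) P⇒Q _   = ind-no P? (¬q ∘ P⇒Q)

  ∑<-rotate : ∀ m f → f m ≡ f 0 → ∑< m (f ∘ suc) ≡ ∑< m f
  ∑<-rotate m f fm≡f0 = +-cancelˡ-≡ (f 0) _ _ (begin
    ∑< (suc m) f                         ≡⟨ cong (λ k → ∑< k f) (+-comm 1 m) ⟩
    ∑< (m + 1) f                         ≡⟨ ∑<-split m 1 f ⟩
    ∑< m f + (f (m + 0) + 0)             ≡⟨ cong (∑< m f +_) (trans (+-identityʳ _) (cong f (+-identityʳ m))) ⟩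
    ∑< m f + f m                         ≡⟨ +-comm (∑< m f) (f m) ⟩
    f m + ∑< m f                         ≡⟨ cong (_+ ∑< m f) fm≡f0 ⟩
    f 0 + ∑< m f                         ∎)
    where open ≡-Reasoning

  -- The start of the period moves one step at a time. It makes the number of diagonals at a vertex
  -- independent of where the polygon is cut.
  ∑<-periodic : ∀ n f → (∀ p → f (n + p) ≡ f p) → ∀ k → ∑< n (λ t → f (k + t)) ≡ ∑< n f
  ∑<-periodic n f period zero    = refl
  ∑<-periodic n f period (suc k) = trans
    (trans (∑<-cong n λ {t} _ → cong f (sym (+-suc k t)))
      (∑<-rotate n (λ t → f (k + t)) (trans (cong f (+-comm k n)) (trans (period k) (cong f (sym (+-identityʳ k)))))))
    (∑<-periodic n f period k)

  length-filter-map-upTo : {A : Set} {P : A → Set} (P? : Decidable P) (g : ℕ → A) (m : ℕ) →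
    length (filter P? (map g (upTo m))) ≡ ∑< m (λ t → ind (P? (g t)))
  length-filter-map-upTo {A} P? g m = go (λ t → t) m
    where
    go : ∀ h m → length (filter P? (map g (applyUpTo h m))) ≡ ∑< m (λ t → ind (P? (g (h t))))
    go h zero    = refl
    go h (suc m) with does (P? (g (h 0)))
    ... | true  = cong suc (go (h ∘ suc) m)
    ... | false = go (h ∘ suc) m

-- Counting diagonals in a triangulation seen from a base edge

module Windows where
  open import Data.Nat using (_+_; _<_; _≤_)
  open import Data.Nat.Properties
  open Sums

  -- `E` is a parameter because such trees occur twice: for the chords of the polygon cut at v_0,
  -- and for the edges of an arbitrary window.
  data Tree (E : ℕ → ℕ → Set) : ℕ → ℕ → Set where
    leaf : ∀ {b} → E b (suc b) → Tree E b (suc b)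
    node : ∀ {b g a} → E b a → Tree E b g → Tree E g a → Tree E b a

  module _ {E : ℕ → ℕ → Set} where

    tree-edge : ∀ {b a} → Tree E b a → E b a
    tree-edge (leaf ba)     = ba
    tree-edge (node ba _ _) = ba

    tree-< : ∀ {b a} → Tree E b a → b < a
    tree-< (leaf _)     = ≤-refl
    tree-< (node _ l r) = <-trans (tree-< l) (tree-< r)

    -- Vertex data `P` is known at both ends of a base side and side data `W` on it; passing to the
    -- apex and the two other sides of the cell reaches every vertex in between. The degrees of
    -- labels use it with `W` the weight, the positivity of the frieze with `W` trivial.
    tree-induction : (P : ℕ → Set) (W : ℕ → ℕ → Set) {N : ℕ} →
      (∀ {b g a} → b < g → g < a → a ≤ N → E b g → E g a → E b a →
        W b a → P b → P a → P g × W b g × W g a) →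
      ∀ {b a} → Tree E b a → a ≤ N → W b a → P b → P a →
      ∀ x → b ≤ x → x ≤ a → P x
    tree-induction P W step {b} (leaf _) a≤N w pb pa x b≤x x≤a with m≤n⇒m<n∨m≡n b≤x
    ... | inj₂ refl = pb
    ... | inj₁ b<x  = subst P (≤-antisym b<x x≤a) pa
    tree-induction P W step (node {g = g} ba l r) a≤N w pb pa x b≤x x≤a
      with pg , wl , wr ← step (tree-< l) (tree-< r) a≤N (tree-edge l) (tree-edge r) ba w pb pa
      with ≤-total x g
    ... | inj₁ x≤g = tree-induction P W step l (≤-trans (<⇒≤ (tree-< r)) a≤N) wl pb pg x b≤x x≤g
    ... | inj₂ g≤x = tree-induction P W step r a≤N wr pg pa x g≤x x≤a

  -- A triangulation seen from the base edge v_k v_{k+N}, where N = n - 1: x stands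
  -- for v_{k+x}, E for being joined by a side or a chosen diagonal, and e is 1 on
  -- chosen diagonals and 0 elsewhere.
  record Window (N : ℕ) : Set₁ where
    field
      E        : ℕ → ℕ → Set
      e        : ℕ → ℕ → ℕ
      crossing : ∀ {x y z t} → x < y → y < z → z < t → t ≤ N → E x z → E y t → ⊥
      tree     : ∀ {x y} → x < y → y ≤ N → E x y → Tree E x y
      base     : E 0 N
      e-sym    : ∀ x y → e x y ≡ e y x
      e-self   : ∀ x → e x x ≡ 0
      e-side   : ∀ {x} → x < N → e x (suc x) ≡ 0
      e-base   : e 0 N ≡ 0
      e-edge   : ∀ {x y} → x < y → y ≤ N → e x y ≡ 0 ⊎ e x y ≡ 1 × E x y
      e-chord  : ∀ {x y} → suc x < y → y ≤ N → 0 < x ⊎ y < N → E x y → e x y ≡ 1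

    e-crossingˡ : ∀ {x y z t} → x < y → y < z → z < t → t ≤ N → E y t → e x z ≡ 0
    e-crossingˡ x<y y<z z<t t≤N yt with e-edge (<-trans x<y y<z) (≤-trans (<⇒≤ z<t) t≤N)
    ... | inj₁ xz≡0     = xz≡0
    ... | inj₂ (_ , xz) = ⊥-elim (crossing x<y y<z z<t t≤N xz yt)

    e-crossingʳ : ∀ {x y z t} → x < y → y < z → z < t → t ≤ N → E x z → e y t ≡ 0
    e-crossingʳ x<y y<z z<t t≤N xz with e-edge (<-trans y<z z<t) t≤N
    ... | inj₁ yt≡0     = yt≡0
    ... | inj₂ (_ , yt) = ⊥-elim (crossing x<y y<z z<t t≤N xz yt)

    -- The weight of the side v_b v_a, as base side of a cell, is q^(level b a - 1).
    level : ℕ → ℕ → ℕ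
    level b a = ∑ a (suc N) (e b)

    -- The degree of the label at v_g: lo is 0 for the numerator and 1 for the denominator.
    over : ℕ → ℕ → ℕ
    over lo g = ∑ lo g (λ x → ∑ (suc g) (suc N) (e x))

    -- The lowest degree of the numerator at v_g.
    fan : ℕ → ℕ
    fan g = ∑ 0 g (λ x → e x N)

    module Cell {b g a} (b<g : b < g) (g<a : g < a) (a≤N : a ≤ N)
                (bg : E b g) (ga : E g a) (ba : E b a) where

      private
        b<a = <-trans b<g g<a
        g≤N = ≤-trans (<⇒≤ g<a) a≤N

        beyond-g : ∑ (suc g) (suc N) (e b) ≡ level b a
        beyond-g = trans (∑-split (e b) g<a (m≤n⇒m≤1+n a≤N))
          (cong (_+ level b a) (∑-zero λ g<y y<a → e-crossingˡ b<g g<y y<a a≤N ga))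

        below-b : ∀ {x} → x < b → ∑ (suc b) (suc N) (e x) ≡ ∑ (suc g) (suc N) (e x)
        below-b x<b = trans (∑-split (e _) (s≤s (<⇒≤ b<g)) (s≤s g≤N))
          (cong (_+ ∑ (suc g) (suc N) (e _))
            (∑-zero λ b<y y≤g → e-crossingˡ x<b b<y (≤-trans y≤g g<a) a≤N ba))

      -- A diagonal from v_b ending strictly between v_g and v_a would cross v_g v_a, so only v_b
      -- v_g is new. This is the weight q^ℓ of the labeling rule, with ℓ = `level b a`.
      level-left : suc b < g → level b g ≡ suc (level b a)
      level-left 1+b<g = trans (∑-first (e b) (s≤s g≤N))
        (cong₂ _+_ (e-chord 1+b<g g≤N (inj₂ (≤-trans g<a a≤N)) bg) beyond-g)

      -- Diagonals from v_g to beyond v_a would cross v_b v_a; only v_g v_a is left, which is the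
      -- weight 1 of the labeling rule.
      level-right : suc g < a → level g a ≡ 1
      level-right 1+g<a = trans (∑-first (e g) (s≤s a≤N))
        (cong₂ _+_ (e-chord 1+g<a a≤N (inj₁ (≤-trans (s≤s z≤n) b<g)) ga)
          (∑-zero λ { a<y (s≤s y≤N) → e-crossingʳ b<g g<a a<y y≤N ba }))

      -- A diagonal over v_g starting before v_b is the same as one over v_b, since it cannot cross
      -- v_b v_a; those starting at v_b are counted by the level; a start strictly between v_b and
      -- v_g would cross v_b v_g. The right side is the degree of the summand q^ℓ r_b or q^ℓ s_b.
      over-apex : ∀ {lo} → lo ≤ b → over lo g ≡ over lo b + level b a
      over-apex {lo} lo≤b = begin
        over lo g                          ≡⟨ ∑-split f lo≤b (<⇒≤ b<g) ⟩
        ∑ lo b f + ∑ b g f                 ≡⟨ cong₂ _+_ (sym (∑-cong λ _ x<b → below-b x<b)) (∑-first f b<g) ⟩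
        over lo b + (f b + ∑ (suc b) g f)  ≡⟨ cong (over lo b +_) (cong₂ _+_ beyond-g inner≡0) ⟩
        over lo b + (level b a + 0)        ≡⟨ cong (over lo b +_) (+-identityʳ _) ⟩
        over lo b + level b a              ∎
        where
        open ≡-Reasoning
        f = λ x → ∑ (suc g) (suc N) (e x)
        inner≡0 : ∑ (suc b) g f ≡ 0
        inner≡0 = ∑-zero λ b<x x<g → ∑-zero λ { g<y (s≤s y≤N) → e-crossingʳ b<x x<g g<y y≤N bg }

      -- The diagonal v_b v_a lies over v_g but not over v_a. Hence the summand with q^ℓ wins at the
      -- top.
      over-< : ∀ {lo} → lo ≤ b → e b a ≡ 1 → over lo a < over lo g
      over-< {lo} lo≤b ba≡1 = begin-strict
        over lo a                              ≡⟨ ∑-split f lo≤b (<⇒≤ b<a) ⟩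
        ∑ lo b f + ∑ b a f                     ≡⟨ cong (∑ lo b f +_) (∑-first f b<a) ⟩
        ∑ lo b f + (f b + ∑ (suc b) a f)       ≡⟨ cong (λ z → ∑ lo b f + (f b + z)) inner≡0 ⟩
        ∑ lo b f + (f b + 0)                   ≡⟨ cong (∑ lo b f +_) (+-identityʳ _) ⟩
        ∑ lo b f + f b                         <⟨ +-mono-≤-< (∑-mono λ _ x<b → further x<b) (≤-reflexive (sym first)) ⟩
        over lo b + level b a                  ≡⟨ over-apex lo≤b ⟨
        over lo g                              ∎
        where
        open ≤-Reasoning
        f = λ x → ∑ (suc a) (suc N) (e x)
        first : level b a ≡ suc (f b)
        first = trans (∑-first (e b) (s≤s a≤N)) (cong (_+ f b) ba≡1)
        inner≡0 : ∑ (suc b) a f ≡ 0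
        inner≡0 = ∑-zero λ b<x x<a → ∑-zero λ { a<y (s≤s y≤N) → e-crossingʳ b<x x<a a<y y≤N ba }
        further : ∀ {x} → x < b → f x ≤ ∑ (suc b) (suc N) (e x)
        further x<b = ≤-trans (m≤n+m (f _) _)
          (≤-reflexive (sym (∑-split (e _) (s≤s (<⇒≤ b<a)) (s≤s a≤N))))

      -- The case b = 0 of the denominators, where s_b = 0: a diagonal starting strictly inside the
      -- base side cannot pass over its end.
      over-base : ∀ {lo} → b < lo → over lo g ≡ 0 × over lo a ≡ 0
      over-base b<lo =
        ∑-zero (λ lo≤x x<g → ∑-zero λ { g<y (s≤s y≤N) → e-crossingʳ (<-≤-trans b<lo lo≤x) x<g g<y y≤N bg }) ,
        ∑-zero (λ lo≤x x<a → ∑-zero λ { a<y (s≤s y≤N) → e-crossingʳ (<-≤-trans b<lo lo≤x) x<a a<y y≤N ba })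

      fan-apex : fan g ≡ fan b + e b N
      fan-apex = begin
        fan g                            ≡⟨ ∑-split f z≤n (<⇒≤ b<g) ⟩
        fan b + ∑ b g f                  ≡⟨ cong (fan b +_) (∑-first f b<g) ⟩
        fan b + (e b N + ∑ (suc b) g f)  ≡⟨ cong (λ z → fan b + (e b N + z)) inner≡0 ⟩
        fan b + (e b N + 0)              ≡⟨ cong (fan b +_) (+-identityʳ _) ⟩
        fan b + e b N                    ∎
        where
        open ≡-Reasoning
        f = λ x → e x N
        inner≡0 : ∑ (suc b) g f ≡ 0
        inner≡0 = ∑-zero λ b<x x<g → e-crossingʳ b<x x<g (<-≤-trans g<a a≤N) ≤-refl bg

      -- A diagonal to v_N from a vertex in g, ..., a - 1 would cross v_b v_a, so r_g inherits its
      -- lowest degree from r_a.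
      fan-right : a < N → fan a ≡ fan g
      fan-right a<N = trans (∑-split f z≤n (<⇒≤ g<a))
        (trans (cong (fan g +_) inner≡0) (+-identityʳ _))
        where
        f = λ x → e x N
        inner≡0 : ∑ g a f ≡ 0
        inner≡0 = ∑-zero λ g≤x x<a → e-crossingʳ (<-≤-trans b<g g≤x) x<a a<N ≤-refl ba

      -- The level counts v_b v_a in addition to a possible v_b v_N, so the summand q^ℓ r_b starts
      -- strictly above the lowest term of r_a.
      fan-< : a < N → e b a ≡ 1 → fan g < fan b + level b a
      fan-< a<N ba≡1 = begin-strict
        fan g              ≡⟨ fan-apex ⟩
        fan b + e b N      <⟨ +-monoʳ-< (fan b) lower ⟩
        fan b + level b a  ∎
        where
        open ≤-Reasoning
        lower : e b N < level b a
        lower = begin-strict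
          e b N                            ≤⟨ m≤n+m (e b N) _ ⟩
          ∑ (suc a) N (e b) + e b N        ≡⟨ ∑-last (e b) a<N ⟨
          ∑ (suc a) (suc N) (e b)          <⟨ ≤-refl ⟩
          1 + ∑ (suc a) (suc N) (e b)      ≡⟨ cong (_+ ∑ (suc a) (suc N) (e b)) ba≡1 ⟨
          e b a + ∑ (suc a) (suc N) (e b)  ≡⟨ ∑-first (e b) (s≤s a≤N) ⟨
          level b a                        ∎

-- Maximal noncrossing families of pairs and their tree of cells

module NoncrossingChords where
  open import Data.Nat using (_+_; _<_; _≤_; _≤?_)
  open import Data.Nat.Properties
  open Sums
  open Windows

  module _ {A : Set} {P Q R : A → Set} (P? : Decidable P) (Q? : Decidable Q) (R? : Decidable R) where

    length-filter-∪ : ∀ xs → (∀ {x} → x ∈ xs → P x → Q x ⊎ R x) →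
      length (filter P? xs) ≤ length (filter Q? xs) + length (filter R? xs)
    length-filter-∪ []       P⊆ = z≤n
    length-filter-∪ (x ∷ xs) P⊆ with ih ← length-filter-∪ xs (P⊆ ∘ there) | P? x
    ... | yes p with P⊆ (here refl) p | Q? x | R? x
    ...   | inj₁ q | no ¬q | _     = ⊥-elim (¬q q)
    ...   | inj₂ r | _     | no ¬r = ⊥-elim (¬r r)
    ...   | _      | yes _ | no _  = s≤s ih
    ...   | _      | no _  | yes _ = ≤-trans (s≤s ih) (≤-reflexive (sym (+-suc _ _)))
    ...   | _      | yes _ | yes _ = s≤s (≤-trans ih (+-monoʳ-≤ _ (n≤1+n _)))
    length-filter-∪ (x ∷ xs) P⊆ | no _ with Q? x | R? x
    ...   | no _  | no _  = ih
    ...   | yes _ | no _  = m≤n⇒m≤1+n ih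
    ...   | no _  | yes _ = ≤-trans ih (+-monoʳ-≤ _ (n≤1+n _))
    ...   | yes _ | yes _ = m≤n⇒m≤1+n (≤-trans ih (+-monoʳ-≤ _ (n≤1+n _)))

  length-unique-≤1 : {A : Set} {xs : List A} → Unique xs →
    (∀ {x y} → x ∈ xs → y ∈ xs → x ≡ y) → length xs ≤ 1
  length-unique-≤1 {xs = []}         _                   _     = z≤n
  length-unique-≤1 {xs = _ ∷ []}     _                   _     = ≤-refl
  length-unique-≤1 {xs = _ ∷ _ ∷ _}  ((x≢y ∷ _) ∷ _) equal =
    ⊥-elim (x≢y (equal (here refl) (there (here refl))))

  +-squeeze : ∀ {x y X Y} → x ≤ X → y ≤ Y → X + Y ≤ x + y → x ≡ X × y ≡ Y
  +-squeeze {x} {y} {X} {Y} x≤X y≤Y le =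
    ≤-antisym x≤X (+-cancelʳ-≤ Y X x (≤-trans le (+-monoʳ-≤ x y≤Y))) ,
    ≤-antisym y≤Y (+-cancelˡ-≤ X Y y (≤-trans le (+-monoˡ-≤ y x≤X)))

  module Chords (N : ℕ) (2≤N : 2 ≤ N) (ds : List (ℕ × ℕ)) (unique : Unique ds)
    (long : ∀ {x y} → (x , y) ∈ ds → suc x < y)
    (bounded : ∀ {x y} → (x , y) ∈ ds → y ≤ N)
    (noncrossing : ∀ {x y z t} → (x , z) ∈ ds → (y , t) ∈ ds → x < y → y < z → z < t → ⊥)
    (number : suc (length ds) ≡ N)
    where

    open DecMembership (≡-dec ℕ._≟_ ℕ._≟_) using (_∈?_)

    Chord : ℕ → ℕ → Set
    Chord x y = y ≡ suc x ⊎ (x , y) ∈ ds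

    chord? : ∀ x y → Dec (Chord x y)
    chord? x y = y ℕ.≟ suc x ⊎-dec (x , y) ∈? ds

    chord-crossing : ∀ {x y z t} → x < y → y < z → z < t → Chord x z → Chord y t → ⊥
    chord-crossing x<y y<z z<t (inj₁ refl) _           = <⇒≱ y<z x<y
    chord-crossing x<y y<z z<t (inj₂ _)    (inj₁ refl) = <⇒≱ z<t y<z
    chord-crossing x<y y<z z<t (inj₂ xz)   (inj₂ yt)   = noncrossing xz yt x<y y<z z<t

    Inside : ℕ → ℕ → ℕ × ℕ → Set
    Inside b a (x , y) = b ≤ x × y ≤ a

    inside? : ∀ b a → Decidable (Inside b a)
    inside? b a (x , y) = b ≤? x ×-dec y ≤? a

    ∣inside∣ : ℕ → ℕ → ℕ
    ∣inside∣ b a = length (filter (inside? b a) ds)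

    -- The pair (b , b + 1) is always a chord, so the search cannot fail. The result is the apex of
    -- the cell to be found under a longer pair starting at b.
    furthest : ∀ {b} g → b < g →
      ∃[ h ] b < h × h ≤ g × Chord b h × (∀ {y} → h < y → y ≤ g → ¬ Chord b y)
    furthest {b} (suc g) b<1+g with chord? b (suc g)
    ... | yes bg = suc g , b<1+g , ≤-refl , bg , λ g<y y≤g → ⊥-elim (<⇒≱ g<y y≤g)
    ... | no ¬bg with m≤n⇒m<n∨m≡n b<1+g
    ...   | inj₂ 1+b≡1+g = ⊥-elim (¬bg (inj₁ (sym 1+b≡1+g)))
    ...   | inj₁ (s≤s b<g) with h , b<h , h≤g , bh , none ← furthest g b<g =
      h , b<h , m≤n⇒m≤1+n h≤g , bh , none′
      where
      none′ : ∀ {y} → h < y → y ≤ suc g → ¬ Chord b y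
      none′ h<y y≤1+g by with m≤n⇒m<n∨m≡n y≤1+g
      ... | inj₁ (s≤s y≤g) = none h<y y≤g by
      ... | inj₂ refl      = ¬bg by

    -- A pair inside b, ..., a + 1 that lies on neither side of `h` would cross (b , h), unless it
    -- starts at b; then maximality of `h` leaves only (b , a + 1).
    module Split {b h a} (bh : Chord b h)
      (none : ∀ {y} → h < y → y ≤ a → ¬ Chord b y) where

      is-ba? : Decidable (_≡ (b , suc a))
      is-ba? d = ≡-dec ℕ._≟_ ℕ._≟_ d (b , suc a)

      ∣ba∣ : ℕ
      ∣ba∣ = length (filter is-ba? ds)

      ∣ba∣≤1 : ∣ba∣ ≤ 1
      ∣ba∣≤1 = length-unique-≤1 (Unique.filter⁺ is-ba? unique) λ x∈ y∈ →
        trans (proj₂ (∈-filter⁻ is-ba? {xs = ds} x∈)) (sym (proj₂ (∈-filter⁻ is-ba? {xs = ds} y∈)))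

      ba∈ds : ∣ba∣ ≡ 1 → (b , suc a) ∈ ds
      ba∈ds eq with filter is-ba? ds in filter≡
      ... | d ∷ _ with d∈ds , refl ← ∈-filter⁻ is-ba? {xs = ds} (subst (d ∈_) (sym filter≡) (here refl)) = d∈ds

      classify : ∀ {d} → d ∈ ds → Inside b (suc a) d → d ≡ (b , suc a) ⊎ Inside b h d ⊎ Inside h (suc a) d
      classify {x , y} d∈ds (b≤x , y≤a) with y ≤? h | h ≤? x
      ... | yes y≤h | _       = inj₂ (inj₁ (b≤x , y≤h))
      ... | no _    | yes h≤x = inj₂ (inj₂ (h≤x , y≤a))
      ... | no y≰h  | no h≰x with m≤n⇒m<n∨m≡n b≤x
      ...   | inj₁ b<x  = ⊥-elim (chord-crossing b<x (≰⇒> h≰x) (≰⇒> y≰h) bh (inj₂ d∈ds))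
      ...   | inj₂ refl with m≤n⇒m<n∨m≡n y≤a
      ...     | inj₁ y<a  = ⊥-elim (none (≰⇒> y≰h) (s≤s⁻¹ y<a) (inj₂ d∈ds))
      ...     | inj₂ refl = inj₁ refl

      ∣inside∣-split : ∣inside∣ b (suc a) ≤ ∣ba∣ + (∣inside∣ b h + ∣inside∣ h (suc a))
      ∣inside∣-split = ≤-trans
        (length-filter-∪ (inside? b (suc a)) is-ba? both? ds classify)
        (+-monoʳ-≤ ∣ba∣ (length-filter-∪ both? (inside? b h) (inside? h (suc a)) ds λ _ p → p))
        where
        both? : Decidable (λ d → Inside b h d ⊎ Inside h (suc a) d)
        both? d = inside? b h d ⊎-dec inside? h (suc a) d

      ∣inside∣-split′ : ∣inside∣ b (suc a) + suc b + suc h ≤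
        ∣ba∣ + (∣inside∣ b h + suc b + (∣inside∣ h (suc a) + suc h))
      ∣inside∣-split′ = ≤-trans
        (+-monoˡ-≤ (suc h) (+-monoˡ-≤ (suc b) ∣inside∣-split))
        (≤-reflexive (regroup ∣ba∣ (∣inside∣ b h) (∣inside∣ h (suc a)) (suc b) (suc h)))
        where
        regroup : ∀ o p q s t → o + (p + q) + s + t ≡ o + (p + s + (q + t))
        regroup = ℕ.solve-∀

    -- The bounds h - b - 1 and (a + 1) - h - 1 of the two halves and 1 for the pair itself add up
    -- to exactly (a + 1) - b - 1. `m` bounds the length of the interval and is fuel for the
    -- recursion into both halves.
    ∣inside∣-bound : ∀ m {b a} → b < a → a ≤ m + b → ∣inside∣ b a + suc b ≤ a
    ∣inside∣-bound zero    b<a a≤b = ⊥-elim (<⇒≱ b<a a≤b)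
    ∣inside∣-bound (suc m) {b} {suc a} b<1+a a≤m+b with m≤n⇒m<n∨m≡n b<1+a
    ... | inj₂ refl = +-monoˡ-≤ (suc b) (≤-reflexive (cong length (filter-none (inside? b (suc b))
      (All.tabulate λ { d∈ds (b≤x , y≤1+b) → <⇒≱ (long d∈ds) (≤-trans y≤1+b (s≤s b≤x)) }))))
    ... | inj₁ (s≤s b<a) with h , b<h , h≤a , bh , none ← furthest a b<a =
      +-cancelʳ-≤ (suc h) _ _ (≤-trans ∣inside∣-split′ (≤-trans
        (+-mono-≤ ∣ba∣≤1 (+-mono-≤
          (∣inside∣-bound m b<h (≤-trans h≤a (s≤s⁻¹ a≤m+b)))
          (∣inside∣-bound m (s≤s h≤a) (≤-trans a≤m+b (subst (_≤ m + h) (+-suc m b) (+-monoʳ-≤ m b<h))))))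
        (≤-reflexive (trans (cong suc (+-comm h (suc a))) (sym (+-suc (suc a) h))))))
      where
      open Split bh none

    -- Equality in the sum forces equality in all three summands: the pair (b , a + 1) is present
    -- and both halves are tight again.
    tight⇒tree : ∀ m {b a} → b < a → a ≤ m + b → ∣inside∣ b a + suc b ≡ a → Tree Chord b a
    tight⇒tree zero    b<a a≤b _ = ⊥-elim (<⇒≱ b<a a≤b)
    tight⇒tree (suc m) {b} {suc a} b<1+a a≤m+b tight with m≤n⇒m<n∨m≡n b<1+a
    ... | inj₂ refl = leaf (inj₁ refl)
    ... | inj₁ (s≤s b<a) with h , b<h , h≤a , bh , none ← furthest a b<a =
      node (inj₂ (ba∈ds (proj₁ squeezed)))
        (tight⇒tree m b<h fuelˡ (proj₁ (proj₂ squeezed)))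
        (tight⇒tree m (s≤s h≤a) fuelʳ (proj₂ (proj₂ squeezed)))
      where
      open Split bh none
      fuelˡ : h ≤ m + b
      fuelˡ = ≤-trans h≤a (s≤s⁻¹ a≤m+b)
      fuelʳ : suc a ≤ m + h
      fuelʳ = ≤-trans a≤m+b (subst (_≤ m + h) (+-suc m b) (+-monoʳ-≤ m b<h))
      boundˡ = ∣inside∣-bound m b<h fuelˡ
      boundʳ = ∣inside∣-bound m (s≤s h≤a) fuelʳ
      total : 1 + (h + suc a) ≤ ∣ba∣ + (∣inside∣ b h + suc b + (∣inside∣ h (suc a) + suc h))
      total = ≤-trans (≤-reflexive (sym (trans (cong (_+ suc h) tight)
        (trans (+-suc (suc a) h) (cong suc (+-comm (suc a) h)))))) ∣inside∣-split′
      squeezed : ∣ba∣ ≡ 1 × ∣inside∣ b h + suc b ≡ h × ∣inside∣ h (suc a) + suc h ≡ suc a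
      squeezed with o , rest ← +-squeeze ∣ba∣≤1 (+-mono-≤ boundˡ boundʳ) total =
        o , +-squeeze boundˡ boundʳ (≤-reflexive (sym rest))

    triangulated : Tree Chord 0 N
    triangulated = tight⇒tree N (≤-trans (s≤s z≤n) 2≤N) (≤-reflexive (sym (+-identityʳ N)))
      (trans (cong (λ xs → length xs + 1) (filter-all (inside? 0 N) (All.tabulate λ d∈ → z≤n , bounded d∈)))
        (trans (+-comm (length ds) 1) number))

    -- A chord straddling `g` crosses one of the two upper sides of the cell unless it is the base
    -- side.
    locate : ∀ {p g q x y} → Tree Chord p g → Tree Chord g q → p ≤ x → y ≤ q → Chord x y →
      y ≤ g ⊎ g ≤ x ⊎ x ≡ p × y ≡ q
    locate {p} {g} {q} {x} {y} l r p≤x y≤q xy with y ≤? g | g ≤? x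
    ... | yes y≤g | _       = inj₁ y≤g
    ... | no _    | yes g≤x = inj₂ (inj₁ g≤x)
    ... | no y≰g  | no g≰x with m≤n⇒m<n∨m≡n p≤x | m≤n⇒m<n∨m≡n y≤q
    ...   | inj₁ p<x  | _         = ⊥-elim (chord-crossing p<x (≰⇒> g≰x) (≰⇒> y≰g) (tree-edge l) xy)
    ...   | inj₂ _    | inj₁ y<q  = ⊥-elim (chord-crossing (≰⇒> g≰x) (≰⇒> y≰g) y<q xy (tree-edge r))
    ...   | inj₂ refl | inj₂ refl = inj₂ (inj₂ (refl , refl))

    inner-cell : ∀ {p q x y} → Tree Chord p q → p ≤ x → y ≤ q → suc x < y → Chord x y →
      ∃[ g ] x < g × g < y × Chord x g × Chord g y
    inner-cell (leaf _) p≤x y≤q 1+x<y xy = ⊥-elim (<⇒≱ 1+x<y (≤-trans y≤q (s≤s p≤x)))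
    inner-cell (node {g = g} _ l r) p≤x y≤q 1+x<y xy with locate l r p≤x y≤q xy
    ... | inj₁ y≤g                  = inner-cell l p≤x y≤g 1+x<y xy
    ... | inj₂ (inj₁ g≤x)           = inner-cell r g≤x y≤q 1+x<y xy
    ... | inj₂ (inj₂ (refl , refl)) = g , tree-< l , tree-< r , tree-edge l , tree-edge r

    -- The third vertex of the parent cell is its right end if the chord is a left child and its
    -- left end if it is a right child; only the root has no parent.
    outer-cell : ∀ {p q x y} → Tree Chord p q → p ≤ x → y ≤ q → x < y → Chord x y →
      (x ≡ p × y ≡ q)
      ⊎ (∃[ g ] g < x × Chord g x × Chord g y)
      ⊎ (∃[ g ] y < g × g ≤ q × Chord x g × Chord y g)
    outer-cell (leaf _) p≤x y≤q x<y xy = inj₁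
      (≤-antisym (s≤s⁻¹ (≤-trans x<y y≤q)) p≤x , ≤-antisym y≤q (≤-trans (s≤s p≤x) x<y))
    outer-cell {q = q} (node {b = p} {g = g} pq l r) p≤x y≤q x<y xy with locate l r p≤x y≤q xy
    ... | inj₂ (inj₂ eqs)  = inj₁ eqs
    ... | inj₁ y≤g with outer-cell l p≤x y≤g x<y xy
    ...   | inj₁ (refl , refl)                   = inj₂ (inj₂ (q , tree-< r , ≤-refl , pq , tree-edge r))
    ...   | inj₂ (inj₁ before)                   = inj₂ (inj₁ before)
    ...   | inj₂ (inj₂ (h , y<h , h≤g , xh , yh)) = inj₂ (inj₂ (h , y<h , ≤-trans h≤g (<⇒≤ (tree-< r)) , xh , yh))
    outer-cell {q = q} (node {b = p} {g = g} pq l r) p≤x y≤q x<y xy | inj₂ (inj₁ g≤x) with outer-cell r g≤x y≤q x<y xy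
    ...   | inj₁ (refl , refl)                   = inj₂ (inj₁ (p , tree-< l , tree-edge l , pq))
    ...   | inj₂ (inj₁ before)                   = inj₂ (inj₁ before)
    ...   | inj₂ (inj₂ after)                    = inj₂ (inj₂ after)

-- Vertices of the polygon unrolled along the natural numbers

module Residues where
  open import Data.Integer using (ℤ; +_)
  open import Data.Nat using (_+_; _*_; _<_; _≤_)
  open import Data.Nat.Properties

  -- Two remainders of one integer differ by a multiple of n of absolute value below n.
  %ℕ-unique : ∀ {n} .{{_ : NonZero n}} (q : ℤ) {r : ℕ} → r < n → (+ r ℤ.+ q ℤ.* + n) %ℕ n ≡ r
  %ℕ-unique {n} q {r} r<n = sym (ℤ.+-injective (ℤ.i-j≡0⇒i≡j (+ r) (+ r′) difference≡0))
    where
    a = + r ℤ.+ q ℤ.* + n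
    r′ = a %ℕ n
    m = a /ℕ n ℤ.- q
    difference : + r ℤ.- + r′ ≡ m ℤ.* + n
    difference = trans (isolate (+ r) (+ r′) q (+ n))
      (trans (cong (λ z → z ℤ.- + r′ ℤ.- q ℤ.* + n) (a≡a%ℕn+[a/ℕn]*n a n))
        (collect (+ r′) (a /ℕ n) q (+ n)))
      where
      isolate : ∀ r r′ q n → r ℤ.- r′ ≡ r ℤ.+ q ℤ.* n ℤ.- r′ ℤ.- q ℤ.* n
      isolate = ℤ.solve-∀
      collect : ∀ r′ p q n → r′ ℤ.+ p ℤ.* n ℤ.- r′ ℤ.- q ℤ.* n ≡ (p ℤ.- q) ℤ.* n
      collect = ℤ.solve-∀
    small : ℤ.∣ m ∣ * n < 1 * n
    small = begin-strict
      ℤ.∣ m ∣ * n          ≡⟨ ℤ.abs-* m (+ n) ⟨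
      ℤ.∣ m ℤ.* + n ∣      ≡⟨ cong ℤ.∣_∣ difference ⟨
      ℤ.∣ + r ℤ.- + r′ ∣   ≡⟨ cong ℤ.∣_∣ (ℤ.m-n≡m⊖n r r′) ⟩
      ℤ.∣ r ℤ.⊖ r′ ∣       ≤⟨ ℤ.∣m⊝n∣≤m⊔n r r′ ⟩
      r ℕ.⊔ r′             <⟨ ⊔-lub r<n (n%ℕd<d a n) ⟩
      n                    ≡⟨ *-identityˡ n ⟨
      1 * n                ∎
      where open ≤-Reasoning
    difference≡0 : + r ℤ.- + r′ ≡ + 0
    difference≡0 = trans difference (cong (ℤ._* + n) {m} {+ 0}
      (ℤ.∣i∣≡0⇒i≡0 (n<1⇒n≡0 (*-cancelʳ-< n ℤ.∣ m ∣ 1 small))))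

  module _ {n : ℕ} .{{_ : NonZero n}} where

    v-≡ : ∀ j k → j %ℕ n ≡ k %ℕ n → v {n} j ≡ v k
    v-≡ _ _ eq = Fin.fromℕ<-cong _ _ eq _ _

    residue-+ : ∀ k x → (k ℤ.+ + x) %ℕ n ≡ (k %ℕ n + x) % n
    residue-+ k x = trans (cong (_%ℕ n) shift) (%ℕ-unique (k /ℕ n ℤ.+ + (ρ+x / n)) (m%n<n ρ+x n))
      where
      ρ+x = k %ℕ n + x
      regroup : ∀ r q x n → r ℤ.+ q ℤ.* n ℤ.+ x ≡ r ℤ.+ x ℤ.+ q ℤ.* n
      regroup = ℤ.solve-∀
      regroup′ : ∀ s p q n → s ℤ.+ p ℤ.* n ℤ.+ q ℤ.* n ≡ s ℤ.+ (q ℤ.+ p) ℤ.* n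
      regroup′ = ℤ.solve-∀
      shift : k ℤ.+ + x ≡ + (ρ+x % n) ℤ.+ (k /ℕ n ℤ.+ + (ρ+x / n)) ℤ.* + n
      shift = trans (cong (ℤ._+ + x) (a≡a%ℕn+[a/ℕn]*n k n))
        (trans (regroup (+ (k %ℕ n)) (k /ℕ n) (+ x) (+ n))
          (trans (cong (ℤ._+ (k /ℕ n) ℤ.* + n) (a≡a%ℕn+[a/ℕn]*n (+ ρ+x) n))
            (regroup′ (+ (ρ+x % n)) (+ (ρ+x / n)) (k /ℕ n) (+ n))))

    opaque
      -- Natural positions let a window starting at a residue ρ run through ρ, ..., ρ + N in
      -- increasing order, across the cut at v_0.
      V : ℕ → Fin n
      V p = v (+ p)

      toℕ-V : ∀ p → toℕ (V p) ≡ p % n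
      toℕ-V p = Fin.toℕ-fromℕ< (n%ℕd<d (+ p) n)

      v≡V : ∀ k x → v (k ℤ.+ + x) ≡ V (k %ℕ n + x)
      v≡V k x = v-≡ (k ℤ.+ + x) (+ (k %ℕ n + x)) (residue-+ k x)

    V-≡ : ∀ p q → p % n ≡ q % n → V p ≡ V q
    V-≡ p q eq = Fin.toℕ-injective (trans (toℕ-V p) (trans eq (sym (toℕ-V q))))

    V-+n : ∀ p → V (n + p) ≡ V p
    V-+n p = V-≡ (n + p) p (trans (cong (_% n) (+-comm n p)) ([m+n]%n≡m%n p n))

    toℕ-V-< : ∀ {p} → p < n → toℕ (V p) ≡ p
    toℕ-V-< p<n = trans (toℕ-V _) (m<n⇒m%n≡m p<n)

    V-toℕ : ∀ x → V (toℕ x) ≡ x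
    V-toℕ x = Fin.toℕ-injective (toℕ-V-< (Fin.toℕ<n x))

    -- The distance `o` of the two positions is below n and a multiple of n.
    V-injective : ∀ {p q} → p ≤ q → q < n + p → V p ≡ V q → p ≡ q
    V-injective {p} p≤q q<n+p eq with o , refl ← m≤n⇒∃[o]m+o≡n p≤q =
      sym (trans (cong (ℕ._+_ p) o≡0) (+-identityʳ p))
      where
      open ≡-Reasoning
      o<n : o < n
      o<n = +-cancelˡ-< p o n (subst (p + o <_) (+-comm n p) q<n+p)
      same : p % n ≡ (p + o) % n
      same = trans (sym (toℕ-V p)) (trans (cong toℕ eq) (toℕ-V (p + o)))
      multiple : o + p / n * n ≡ (p + o) / n * n
      multiple = +-cancelˡ-≡ (p % n) _ _ (begin
        p % n + (o + p / n * n)            ≡⟨ cong (ℕ._+_ (p % n)) (+-comm o _) ⟩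
        p % n + (p / n * n + o)            ≡⟨ +-assoc (p % n) _ o ⟨
        p % n + p / n * n + o              ≡⟨ cong (_+ o) (m≡m%n+[m/n]*n p n) ⟨
        p + o                              ≡⟨ m≡m%n+[m/n]*n (p + o) n ⟩
        (p + o) % n + (p + o) / n * n      ≡⟨ cong (_+ (p + o) / n * n) same ⟨
        p % n + (p + o) / n * n            ∎)
      o≡0 : o ≡ 0
      o≡0 = begin
        o                        ≡⟨ m<n⇒m%n≡m o<n ⟨
        o % n                    ≡⟨ [m+kn]%n≡m%n o (p / n) n ⟨
        (o + p / n * n) % n      ≡⟨ cong (_% n) multiple ⟩
        ((p + o) / n * n) % n    ≡⟨ m*n%n≡0 ((p + o) / n) n ⟩
        0                        ∎

    toℕ-V-suc : ∀ p → toℕ (V (suc p)) ≡ suc (toℕ (V p)) % n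
    toℕ-V-suc p = trans (toℕ-V (suc p)) (trans (%-distribˡ-+ 1 p n)
      (trans (sym (trans (%-distribˡ-+ 1 (p % n) n) (cong (λ z → (1 % n + z) % n) (m%n%n≡m%n p n))))
        (cong (λ z → suc z % n) (sym (toℕ-V p)))))

    Side⇒V : ∀ p q → Side (V p) (V q) → V q ≡ V (suc p) ⊎ V p ≡ V (suc q)
    Side⇒V p q (inj₁ q≡1+p) = inj₁ (Fin.toℕ-injective (trans q≡1+p (sym (toℕ-V-suc p))))
    Side⇒V p q (inj₂ p≡1+q) = inj₂ (Fin.toℕ-injective (trans p≡1+q (sym (toℕ-V-suc q))))

    V⇒Side : ∀ p q → V q ≡ V (suc p) → Side (V p) (V q)
    V⇒Side p q eq = inj₁ (trans (cong toℕ eq) (toℕ-V-suc p))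

-- Every side of the polygon as the base edge of a window

module Polygons where
  open import Data.Nat using (_+_; _<_; _≤_; _<?_)
  open import Data.Nat.Properties
  open Sums
  open Windows
  open NoncrossingChords
  open Residues

  module Geometry (N : ℕ) (2≤N : 2 ≤ N) (T : Triangulation (suc N)) where
    open Triangulation T
    open DecMembership (≡-dec (Fin._≟_ {suc N}) (Fin._≟_ {suc N})) using (_∈?_)

    private
      n = suc N
      Vertex = Fin n

    edge-sym : ∀ {X Y} → Edge T X Y → Edge T Y X
    edge-sym (inj₁ side) = inj₁ (swap side)
    edge-sym (inj₂ diag) = inj₂ (swap diag)

    residues : Vertex × Vertex → ℕ × ℕ
    residues (X , Y) = toℕ X , toℕ Y

    -- The base edge v_0 v_N is added so that every chord other than a side
    -- v_x v_{x+1} belongs to the list.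
    ds : List (ℕ × ℕ)
    ds = (0 , N) ∷ map residues diagonals

    ds⁻ : ∀ {x y} → (x , y) ∈ ds →
      (x ≡ 0 × y ≡ N) ⊎ (∃[ d ] d ∈ diagonals × IsDiagonal d × residues d ≡ (x , y))
    ds⁻ (here refl) = inj₁ (refl , refl)
    ds⁻ (there d∈) with d , d∈diagonals , eq ← ∈-map⁻ residues d∈ =
      inj₂ (d , d∈diagonals , All.lookup areDiagonal d∈diagonals , sym eq)

    ds-unique : Unique ds
    ds-unique = All.tabulate new ∷ Unique.map⁺ residues-injective distinct
      where
      residues-injective : ∀ {d e} → residues d ≡ residues e → d ≡ e
      residues-injective eq with eq₁ , eq₂ ← ,-injective eq =
        cong₂ _,_ (Fin.toℕ-injective eq₁) (Fin.toℕ-injective eq₂)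
      new : ∀ {d} → d ∈ map residues diagonals → (0 , N) ≢ d
      new d∈ eq with (X , Y) , XY∈ , refl ← ∈-map⁻ residues d∈ with X≡0 , Y≡N ← ,-injective eq =
        proj₂ (All.lookup areDiagonal XY∈)
          (inj₂ (trans (sym X≡0) (sym (trans (cong (λ z → suc z % n) (sym Y≡N)) (n%n≡0 n)))))

    ds-long : ∀ {x y} → (x , y) ∈ ds → suc x < y
    ds-long xy∈ with ds⁻ xy∈
    ... | inj₁ (refl , refl) = 2≤N
    ... | inj₂ ((X , Y) , _ , (X<Y , ¬side) , refl) = ≤∧≢⇒< X<Y λ 1+X≡Y →
      ¬side (inj₁ (sym (trans (m<n⇒m%n≡m (subst (_< n) (sym 1+X≡Y) (Fin.toℕ<n Y))) 1+X≡Y)))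

    ds-bounded : ∀ {x y} → (x , y) ∈ ds → y ≤ N
    ds-bounded xy∈ with ds⁻ xy∈
    ... | inj₁ (refl , refl)               = ≤-refl
    ... | inj₂ ((_ , Y) , _ , _ , refl)    = s≤s⁻¹ (Fin.toℕ<n Y)

    ds-noncrossing : ∀ {x y z t} → (x , z) ∈ ds → (y , t) ∈ ds → x < y → y < z → z < t → ⊥
    ds-noncrossing xz∈ yt∈ x<y y<z z<t with ds⁻ xz∈ | ds⁻ yt∈
    ... | inj₁ (refl , refl) | _                   = <⇒≱ z<t (ds-bounded yt∈)
    ... | inj₂ _             | inj₁ (refl , refl)  = n≮0 x<y
    ... | inj₂ (_ , d∈ , _ , refl) | inj₂ (_ , e∈ , _ , refl) = nonCrossing d∈ e∈ (inj₁ (x<y , y<z , z<t))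

    open Chords N 2≤N ds ds-unique ds-long ds-bounded ds-noncrossing
      (trans (cong (suc ∘ suc) (trans (length-map residues diagonals) number)) (m+[n∸m]≡n 2≤N))

    chord⇒edge : ∀ {x y} → Chord x y → Edge T (V x) (V y)
    chord⇒edge {x} (inj₁ refl) = inj₁ (V⇒Side x (suc x) refl)
    chord⇒edge (inj₂ xy∈) with ds⁻ xy∈
    ... | inj₁ (refl , refl) = inj₁ (swap (V⇒Side N 0 (sym (trans (cong V (sym (+-identityʳ n))) (V-+n 0)))))
    ... | inj₂ ((X , Y) , d∈ , _ , refl) =
      inj₂ (inj₁ (subst (_∈ diagonals) (cong₂ _,_ (sym (V-toℕ X)) (sym (V-toℕ Y))) d∈))

    edge⇒chord : ∀ {x y} → x < y → y ≤ N → Edge T (V x) (V y) → Chord x y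
    edge⇒chord {x} {y} x<y y≤N = from
      where
      x≤N = ≤-trans (<⇒≤ x<y) y≤N
      from : Edge T (V x) (V y) → Chord x y
      from (inj₁ side) with Side⇒V x y side
      ... | inj₁ Vy≡V1+x = inj₁ (sym (V-injective x<y (s≤s (≤-trans y≤N (m≤m+n N (suc x)))) (sym Vy≡V1+x)))
      ... | inj₂ Vx≡V1+y with m≤n⇒m<n∨m≡n y≤N
      ...   | inj₁ y<N  = ⊥-elim (<⇒≢ (m≤n⇒m≤1+n x<y)
        (V-injective (≤-trans (<⇒≤ x<y) (n≤1+n y)) (s≤s (≤-trans y<N (m≤m+n N x))) Vx≡V1+y))
      ...   | inj₂ refl = inj₂ (here (cong (_, N) (trans (sym (toℕ-V-< (s≤s x≤N)))
        (trans (cong toℕ (trans Vx≡V1+y (trans (cong V (sym (+-identityʳ n))) (V-+n 0)))) (toℕ-V-< (s≤s z≤n))))))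
      from (inj₂ (inj₁ xy∈)) = inj₂ (there (subst (_∈ map residues diagonals)
        (cong₂ _,_ (toℕ-V-< (s≤s x≤N)) (toℕ-V-< (s≤s y≤N))) (∈-map⁺ residues xy∈)))
      from (inj₂ (inj₂ yx∈)) = ⊥-elim (<-asym x<y
        (subst₂ _<_ (toℕ-V-< (s≤s y≤N)) (toℕ-V-< (s≤s x≤N)) (proj₁ (All.lookup areDiagonal yx∈))))

    _~_ : ℕ → ℕ → Set
    p ~ q = Edge T (V p) (V q)

    wrapped : ∀ {p q} → p ≤ N → q < p → p ~ (n + q) → Chord q p
    wrapped {p} {q} p≤N q<p pq = edge⇒chord q<p p≤N (edge-sym (subst (Edge T (V p)) (V-+n q) pq))

    unwrap : ∀ {p q} → Chord q p → p ~ (n + q)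
    unwrap {p} {q} qp = subst (Edge T (V p)) (sym (V-+n q)) (edge-sym (chord⇒edge qp))

    data Turn : ℕ → Set where
      low  : ∀ {p} → p ≤ N → Turn p
      high : ∀ p → Turn (n + p)

    turn : ∀ p → Turn p
    turn p with p <? n
    ... | yes p<n = low (s≤s⁻¹ p<n)
    ... | no  p≮n with o , refl ← m≤n⇒∃[o]m+o≡n (≮⇒≥ p≮n) = high o

    ~-shift : ∀ {p q} → (n + p) ~ (n + q) → p ~ q
    ~-shift = subst₂ (Edge T) (V-+n _) (V-+n _)

    ~-shift⁻ : ∀ {p q} → p ~ q → (n + p) ~ (n + q)
    ~-shift⁻ = subst₂ (Edge T) (sym (V-+n _)) (sym (V-+n _))

    -- The four positions span less than one turn, so reduction modulo n only rotates them: those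
    -- past N drop below `a`, and the two edges still alternate in the cut polygon.
    ~-crossing-low : ∀ {a b c d} → a ≤ N → a < b → b < c → c < d → d < n + a → a ~ c → b ~ d → ⊥
    ~-crossing-low {a} {b} {c} {d} a≤N a<b b<c c<d d<n+a ac bd with turn b | turn c | turn d
    ... | low b≤N | low c≤N | low d≤N = chord-crossing a<b b<c c<d
      (edge⇒chord (<-trans a<b b<c) c≤N ac) (edge⇒chord (<-trans b<c c<d) d≤N bd)
    ... | low b≤N | low c≤N | high d′ = chord-crossing (+-cancelˡ-< n d′ a d<n+a) a<b b<c
      (wrapped b≤N (<-trans (+-cancelˡ-< n d′ a d<n+a) a<b) bd) (edge⇒chord (<-trans a<b b<c) c≤N ac)
    ... | low b≤N | high c′ | high d′ = chord-crossing (+-cancelˡ-< n c′ d′ c<d) (+-cancelˡ-< n d′ a d<n+a) a<b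
      (wrapped a≤N (<-trans (+-cancelˡ-< n c′ d′ c<d) (+-cancelˡ-< n d′ a d<n+a)) ac)
      (wrapped b≤N (<-trans (+-cancelˡ-< n d′ a d<n+a) a<b) bd)
    ... | high b′ | high c′ | high d′ = chord-crossing (+-cancelˡ-< n b′ c′ b<c) (+-cancelˡ-< n c′ d′ c<d) d′<a
      (edge⇒chord (<-trans (+-cancelˡ-< n b′ c′ b<c) (+-cancelˡ-< n c′ d′ c<d)) (≤-trans (<⇒≤ d′<a) a≤N) (~-shift bd))
      (wrapped a≤N (<-trans (+-cancelˡ-< n c′ d′ c<d) d′<a) ac)
      where d′<a = +-cancelˡ-< n d′ a d<n+a
    ... | _       | high c′ | low d≤N = <⇒≱ c<d (≤-trans d≤N (m≤n⇒m≤1+n (m≤m+n N c′)))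
    ... | high b′ | low c≤N | _       = <⇒≱ b<c (≤-trans c≤N (m≤n⇒m≤1+n (m≤m+n N b′)))

    -- If `b` lies past the cut, the edge is the chord from b - n to a, and the positions between a
    -- and b lie outside it. The apex is then the one of `outer-cell`, moved one turn on if it
    -- precedes b - n.
    ~-apex-low : ∀ {a b} → a ≤ N → suc a < b → b < n + a → a ~ b →
      ∃[ g ] a < g × g < b × a ~ g × g ~ b
    ~-apex-low {a} {b} a≤N 1+a<b b<n+a ab with turn b
    ... | low b≤N
      with g , a<g , g<b , ag , gb ← inner-cell triangulated z≤n b≤N 1+a<b
             (edge⇒chord (<-trans (n<1+n a) 1+a<b) b≤N ab) =
      g , a<g , g<b , chord⇒edge ag , chord⇒edge gb
    ... | high b′ with b′<a ← +-cancelˡ-< n b′ a b<n+a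
        with outer-cell triangulated z≤n a≤N b′<a (wrapped a≤N b′<a ab)
    -- The root chord would be a = N and b = n, a polygon side, which `1+a<b` excludes.
    ...   | inj₁ (refl , refl) = ⊥-elim (<-irrefl refl (subst (suc N <_) (+-identityʳ (suc N)) 1+a<b))
    ...   | inj₂ (inj₁ (g , g<b′ , gb′ , ga)) =
      n + g , ≤-trans (s≤s a≤N) (m≤m+n n g) , +-monoʳ-< n g<b′ , unwrap ga , ~-shift⁻ (chord⇒edge gb′)
    ...   | inj₂ (inj₂ (g , a<g , g≤N , b′g , ag)) =
      g , a<g , ≤-trans (s≤s g≤N) (m≤m+n n b′) , chord⇒edge ag , unwrap b′g

    ~-crossing : ∀ {a b c d} → a < b → b < c → c < d → d < n + a → a < n + n → a ~ c → b ~ d → ⊥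
    ~-crossing {a} {b} {c} {d} a<b b<c c<d d<n+a a<2n ac bd with turn a
    ... | low a≤N = ~-crossing-low a≤N a<b b<c c<d d<n+a ac bd
    ... | high a′ with turn b | turn c | turn d
    ...   | low b≤N | _       | _       = <⇒≱ a<b (≤-trans b≤N (m≤n⇒m≤1+n (m≤m+n N a′)))
    ...   | high b′ | low c≤N | _       = <⇒≱ b<c (≤-trans c≤N (m≤n⇒m≤1+n (m≤m+n N b′)))
    ...   | high _  | high c′ | low d≤N = <⇒≱ c<d (≤-trans d≤N (m≤n⇒m≤1+n (m≤m+n N c′)))
    ...   | high b′ | high c′ | high d′ = ~-crossing-low (s≤s⁻¹ (+-cancelˡ-< n a′ n a<2n))
      (+-cancelˡ-< n a′ b′ a<b) (+-cancelˡ-< n b′ c′ b<c) (+-cancelˡ-< n c′ d′ c<d)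
      (+-cancelˡ-< n d′ (n + a′) d<n+a) (~-shift ac) (~-shift bd)

    ~-apex : ∀ {a b} → suc a < b → b < n + a → a < n + n → a ~ b →
      ∃[ g ] a < g × g < b × a ~ g × g ~ b
    ~-apex {a} {b} 1+a<b b<n+a a<2n ab with turn a
    ... | low a≤N = ~-apex-low a≤N 1+a<b b<n+a ab
    ... | high a′ with turn b
    ...   | low b≤N = ⊥-elim (<⇒≱ (<-trans (n<1+n _) 1+a<b) (≤-trans b≤N (m≤n⇒m≤1+n (m≤m+n N a′))))
    ...   | high b′
      with g , a<g , g<b , ag , gb ← ~-apex-low (s≤s⁻¹ (+-cancelˡ-< n a′ n a<2n))
             (+-cancelˡ-< n (suc a′) b′ (subst (_< n + b′) (sym (+-suc n a′)) 1+a<b))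
             (+-cancelˡ-< n b′ (n + a′) b<n+a) (~-shift ab) =
      n + g , +-monoʳ-< n a<g , +-monoʳ-< n g<b , ~-shift⁻ ag , ~-shift⁻ gb

    joined? : ∀ X Y → Dec ((X , Y) ∈ diagonals ⊎ (Y , X) ∈ diagonals)
    joined? X Y = (X , Y) ∈? diagonals ⊎-dec (Y , X) ∈? diagonals

    δ : Vertex → Vertex → ℕ
    δ X Y = ind (joined? X Y)

    δ-sym : ∀ X Y → δ X Y ≡ δ Y X
    δ-sym X Y = ind-cong (joined? X Y) (joined? Y X) swap swap

    δ-self : ∀ X → δ X X ≡ 0
    δ-self X = ind-no (joined? X X) Sum.[ irrefl , irrefl ]
      where
      irrefl : (X , X) ∈ diagonals → ⊥
      irrefl XX∈ = <-irrefl refl (proj₁ (All.lookup areDiagonal XX∈))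

    δ-side : ∀ {X Y} → Side X Y → δ X Y ≡ 0
    δ-side {X} {Y} side = ind-no (joined? X Y)
      Sum.[ (λ XY∈ → proj₂ (All.lookup areDiagonal XY∈) side)
          , (λ YX∈ → proj₂ (All.lookup areDiagonal YX∈) (swap side)) ]

    δ-edge : ∀ X Y → δ X Y ≡ 0 ⊎ δ X Y ≡ 1 × Edge T X Y
    δ-edge X Y with joined? X Y
    ... | yes diag = inj₂ (ind-yes (joined? X Y) diag , inj₂ diag)
    ... | no ¬diag = inj₁ (ind-no (joined? X Y) ¬diag)

    δ-chord : ∀ {X Y} → Edge T X Y → ¬ Side X Y → δ X Y ≡ 1
    δ-chord         (inj₁ side) ¬side = ⊥-elim (¬side side)
    δ-chord {X} {Y} (inj₂ diag) _     = ind-yes (joined? X Y) diag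

    module _ {ρ : ℕ} (ρ<n : ρ < n) where

      private
        bound : ∀ {x t} → t ≤ N → ρ + t < n + (ρ + x)
        bound {x} {t} t≤N = subst (_< n + (ρ + x)) (+-comm t ρ)
          (+-mono-<-≤ (s≤s t≤N) (m≤m+n ρ x))
        bound₂ : ∀ {x} → x ≤ N → ρ + x < n + n
        bound₂ x≤N = +-mono-<-≤ ρ<n (m≤n⇒m≤1+n x≤N)

        side-suc : ∀ x → Side {n} (V (ρ + x)) (V (ρ + suc x))
        side-suc x = V⇒Side (ρ + x) (ρ + suc x) (cong V (+-suc ρ x))

        side-base : Side {n} (V (ρ + 0)) (V (ρ + N))
        side-base = swap (V⇒Side (ρ + N) (ρ + 0)
          (trans (cong V (+-identityʳ ρ))
            (sym (trans (cong V (trans (sym (+-suc ρ N)) (+-comm ρ n))) (V-+n ρ)))))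

        window-tree : ∀ m {x y} → x < y → y ≤ N → y ≤ m + x → (ρ + x) ~ (ρ + y) →
          Tree (λ x y → (ρ + x) ~ (ρ + y)) x y
        window-tree zero    x<y y≤N y≤x     xy = ⊥-elim (<⇒≱ x<y y≤x)
        window-tree (suc m) {x} {y} x<y y≤N y≤1+m+x xy with m≤n⇒m<n∨m≡n x<y
        ... | inj₂ refl  = leaf xy
        ... | inj₁ 1+x<y
          with g , a<g , g<b , ag , gb ← ~-apex (subst (_< ρ + y) (+-suc ρ x) (+-monoʳ-< ρ 1+x<y))
                 (bound y≤N) (bound₂ (≤-trans (<⇒≤ x<y) y≤N)) xy
          with o , refl ← m≤n⇒∃[o]m+o≡n (≤-trans (m≤m+n ρ x) (<⇒≤ a<g)) =
          let x<o = +-cancelˡ-< ρ x o a<g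
              o<y = +-cancelˡ-< ρ o y g<b
          in node xy
            (window-tree m x<o (≤-trans (<⇒≤ o<y) y≤N) (s≤s⁻¹ (≤-trans o<y y≤1+m+x)) ag)
            (window-tree m o<y y≤N (≤-trans y≤1+m+x (subst (_≤ m + o) (+-suc m x) (+-monoʳ-≤ m x<o))) gb)

        not-side : ∀ {x y} → suc x < y → y ≤ N → 0 < x ⊎ y < N → ¬ Side {n} (V (ρ + x)) (V (ρ + y))
        not-side {x} {y} 1+x<y y≤N proper side
          with Side⇒V (ρ + x) (ρ + y) side
        ... | inj₁ eq = <⇒≢ 1+x<y (+-cancelˡ-≡ ρ _ _ (trans (+-suc ρ x)
          (V-injective (subst (_≤ ρ + y) (+-suc ρ x) (+-monoʳ-≤ ρ (<⇒≤ 1+x<y)))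
            (subst (λ z → ρ + y < n + z) (+-suc ρ x) (bound y≤N)) (sym eq))))
        ... | inj₂ eq = <⇒≢ (<-trans (<-trans (n<1+n x) 1+x<y) (n<1+n y)) (+-cancelˡ-≡ ρ _ _
          (trans (V-injective
            (≤-trans (+-monoʳ-≤ ρ (≤-trans (<⇒≤ (<-trans (n<1+n x) 1+x<y)) (n≤1+n y))) (≤-reflexive (+-suc ρ y)))
            (subst₂ _<_ (+-suc ρ y)
              (trans (sym (+-assoc ρ n x)) (trans (cong (_+ x) (+-comm ρ n)) (+-assoc n ρ x)))
              (+-monoʳ-< ρ (short proper))) eq) (sym (+-suc ρ y))))
          where
          -- Equality suc y = n + x holds exactly for the base edge x = 0, y = N.
          short : 0 < x ⊎ y < N → suc y < n + x
          short (inj₁ 0<x) = subst (_≤ n + x) (+-comm (suc y) 1) (+-mono-≤ (s≤s y≤N) 0<x)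
          short (inj₂ y<N) = ≤-trans (s≤s y<N) (m≤m+n n x)

      window : Window N
      window = record
        { E        = λ x y → (ρ + x) ~ (ρ + y)
        ; e        = λ x y → δ (V (ρ + x)) (V (ρ + y))
        ; crossing = λ {x} x<y y<z z<t t≤N xz yt → ~-crossing (+-monoʳ-< ρ x<y) (+-monoʳ-< ρ y<z)
            (+-monoʳ-< ρ z<t) (bound {x} t≤N) (bound₂ (≤-trans (<⇒≤ (<-trans x<y (<-trans y<z z<t))) t≤N)) xz yt
        ; tree     = λ x<y y≤N xy → window-tree N x<y y≤N (≤-trans y≤N (m≤m+n N _)) xy
        ; base     = inj₁ side-base
        ; e-sym    = λ x y → δ-sym (V (ρ + x)) (V (ρ + y))
        ; e-self   = λ x → δ-self (V (ρ + x))
        ; e-side   = λ {x} _ → δ-side (side-suc x)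
        ; e-base   = δ-side side-base
        ; e-edge   = λ {x} {y} _ _ → δ-edge (V (ρ + x)) (V (ρ + y))
        ; e-chord  = λ 1+x<y y≤N proper xy → δ-chord xy (not-side 1+x<y y≤N proper)
        }

-- The quiddity as one more than the number of diagonals at a vertex

module Quiddities where
  open import Data.Nat using (_+_; _∸_; _<_; _≤_)
  open import Data.Nat.Properties
  open Sums
  open Windows
  open Residues
  open Polygons

  -- Injectivity is asked on members only: `lastVertex` is injective on the cells at X, not on all
  -- triples.
  unique-map : {A B : Set} {f : A → B} {xs : List A} →
    (∀ {x y} → x ∈ xs → y ∈ xs → f x ≡ f y → x ≡ y) → Unique xs → Unique (map f xs)
  unique-map                 inj []             = []
  unique-map {f = f} {x ∷ xs} inj (x∉xs ∷ uniq) =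
    All.tabulate new ∷ unique-map (λ x∈ y∈ → inj (there x∈) (there y∈)) uniq
    where
    new : ∀ {z} → z ∈ map f xs → f x ≢ z
    new z∈ fx≡z with y , y∈ , refl ← ∈-map⁻ f z∈ = All.lookup x∉xs y∈ (inj (here refl) (there y∈) fx≡z)

  module Quiddity (N : ℕ) (2≤N : 2 ≤ N) (T : Triangulation (suc N)) where
    open Geometry N 2≤N T

    private
      n = suc N
      Vertex = Fin n

    module _ (X : Vertex) where

      private
        ρ = toℕ X
        ρ<n = Fin.toℕ<n X

      Triple = Vertex × Vertex × Vertex

      contains? : Decidable {A = Triple} (λ (x , y , z) → X ≡ x ⊎ X ≡ y ⊎ X ≡ z)
      contains? (x , y , z) = X Fin.≟ x ⊎-dec X Fin.≟ y ⊎-dec X Fin.≟ z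

      sortedCell? : Decidable {A = Triple} (λ (x , y , z) → x Fin.< y × y Fin.< z × Cell T x y z)
      sortedCell? (x , y , z) = x Fin.<? y ×-dec y Fin.<? z ×-dec cell? T x y z

      cellsAt : List Triple
      cellsAt = filter contains? (cells T)

      cellsAt⁻ : ∀ {x y z} → (x , y , z) ∈ cellsAt →
        (X ≡ x ⊎ X ≡ y ⊎ X ≡ z) × x Fin.< y × y Fin.< z × Cell T x y z
      cellsAt⁻ t∈ with t∈cells , X∈t ← ∈-filter⁻ contains? {xs = cells T} t∈ =
        X∈t , proj₂
          (∈-filter⁻ sortedCell? {xs = cartesianProduct (allFin n) (cartesianProduct (allFin n) (allFin n))} t∈cells)

      cellsAt⁺ : ∀ {x y z} → X ≡ x ⊎ X ≡ y ⊎ X ≡ z → x Fin.< y → y Fin.< z → Cell T x y z →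
        (x , y , z) ∈ cellsAt
      cellsAt⁺ {x} {y} {z} X∈t x<y y<z cell = ∈-filter⁺ contains?
        (∈-filter⁺ sortedCell? (∈-cartesianProduct⁺ (∈-allFin x) (∈-cartesianProduct⁺ (∈-allFin y) (∈-allFin z)))
          (x<y , y<z , cell)) X∈t

      cellsAt-unique : Unique cellsAt
      cellsAt-unique = Unique.filter⁺ contains? (Unique.filter⁺ sortedCell?
        (Unique.cartesianProduct⁺ (Unique.allFin⁺ n) (Unique.cartesianProduct⁺ (Unique.allFin⁺ n) (Unique.allFin⁺ n))))

      -- For a cell at X, the position in (ρ , ρ + n) of its last vertex when
      -- the polygon is traversed from X.
      lastVertex : Triple → ℕ
      lastVertex (x , y , z) with X Fin.≟ x | X Fin.≟ y
      ... | yes _ | _     = toℕ z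
      ... | no  _ | yes _ = n + toℕ x
      ... | no  _ | no  _ = n + toℕ y

      lastVertex-first : ∀ y z → lastVertex (X , y , z) ≡ toℕ z
      lastVertex-first y z with X Fin.≟ X
      ... | yes _   = refl
      ... | no  X≢X = ⊥-elim (X≢X refl)

      lastVertex-second : ∀ {x} z → x Fin.< X → lastVertex (x , X , z) ≡ n + toℕ x
      lastVertex-second {x} z x<X with X Fin.≟ x | X Fin.≟ X
      ... | yes refl | _       = ⊥-elim (<-irrefl refl x<X)
      ... | no _     | yes _   = refl
      ... | no _     | no X≢X  = ⊥-elim (X≢X refl)

      lastVertex-third : ∀ {x y} → x Fin.< y → y Fin.< X → lastVertex (x , y , X) ≡ n + toℕ y
      lastVertex-third {x} {y} x<y y<X with X Fin.≟ x | X Fin.≟ y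
      ... | yes refl | _        = ⊥-elim (<-asym x<y y<X)
      ... | no _     | yes refl = ⊥-elim (<-irrefl refl y<X)
      ... | no _     | no _     = refl

      record Around (g a : ℕ) : Set where
        constructor around
        field
          ρ<g   : ρ < g
          g<a   : g < a
          a<ρ+n : a < n + ρ
          ρ~g   : Edge T X (V g)
          g~a   : Edge T (V g) (V a)
          ρ~a   : Edge T X (V a)

      -- Cells are listed with increasing vertices, so the listed form depends on how many of `g`
      -- and `a` lie past the cut at v_0.
      Rotation : Triple → ℕ → ℕ → Set
      Rotation t g a = t ≡ (X , V g , V a) ⊎ t ≡ (V a , X , V g) ⊎ t ≡ (V g , V a , X)

      around-cell : ∀ {t} → t ∈ cellsAt → ∃[ g ] Around g (lastVertex t) × Rotation t g (lastVertex t)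
      around-cell {x , y , z} t∈ with cellsAt⁻ t∈
      ... | inj₁ refl , x<y , y<z , xy , yz , xz rewrite lastVertex-first y z =
        toℕ y , around x<y y<z (≤-trans (Fin.toℕ<n z) (m≤m+n n ρ))
          (subst (Edge T X) (sym (V-toℕ y)) xy) (subst₂ (Edge T) (sym (V-toℕ y)) (sym (V-toℕ z)) yz)
          (subst (Edge T X) (sym (V-toℕ z)) xz)
        , inj₁ (cong₂ (λ g a → X , g , a) (sym (V-toℕ y)) (sym (V-toℕ z)))
      ... | inj₂ (inj₁ refl) , x<y , y<z , xy , yz , xz rewrite lastVertex-second z x<y =
        toℕ z , around y<z (≤-trans (Fin.toℕ<n z) (m≤m+n n (toℕ x))) (+-monoʳ-< n x<y)
          (subst (Edge T X) (sym (V-toℕ z)) yz) (subst₂ (Edge T) (sym (V-toℕ z)) (sym Vx) (edge-sym xz))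
          (subst (Edge T X) (sym Vx) (edge-sym xy))
        , inj₂ (inj₁ (cong₂ (λ a g → a , X , g) (sym Vx) (sym (V-toℕ z))))
        where
        Vx : V (n + toℕ x) ≡ x
        Vx = trans (V-+n (toℕ x)) (V-toℕ x)
      ... | inj₂ (inj₂ refl) , x<y , y<z , xy , yz , xz rewrite lastVertex-third x<y y<z =
        n + toℕ x , around (≤-trans ρ<n (m≤m+n n (toℕ x))) (+-monoʳ-< n x<y) (+-monoʳ-< n y<z)
          (subst (Edge T X) (sym Vx) (edge-sym xz)) (subst₂ (Edge T) (sym Vx) (sym Vy) xy)
          (subst (Edge T X) (sym Vy) (edge-sym yz))
        , inj₂ (inj₂ (cong₂ (λ g a → g , a , X) (sym Vx) (sym Vy)))
        where
        Vx : V (n + toℕ x) ≡ x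
        Vx = trans (V-+n (toℕ x)) (V-toℕ x)
        Vy : V (n + toℕ y) ≡ y
        Vy = trans (V-+n (toℕ y)) (V-toℕ y)

      -- Otherwise the side from X to `V h` of one cell would cross the side from `V g` to `V a` of
      -- the other.
      around-≯ : ∀ {g h a} → Around g a → Around h a → ¬ g < h
      around-≯ (around ρ<g _ _ _ ga _) (around _ h<a a<ρ+n ρh _ _) g<h =
        ~-crossing ρ<g g<h h<a a<ρ+n (≤-trans ρ<n (m≤m+n n n))
          (subst (λ Z → Edge T Z (V _)) (sym (V-toℕ X)) ρh) ga

      around-unique : ∀ {g h a} → Around g a → Around h a → g ≡ h
      around-unique A B = ≤-antisym (≮⇒≥ (around-≯ B A)) (≮⇒≥ (around-≯ A B))

      Sorted : Triple → Set
      Sorted (x , y , z) = x Fin.< y × y Fin.< z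

      cellsAt-sorted : ∀ {t} → t ∈ cellsAt → Sorted t
      cellsAt-sorted {_ , _ , _} t∈ with _ , x<y , y<z , _ ← cellsAt⁻ t∈ = x<y , y<z

      rotation-unique : ∀ {t u g a} → Sorted t → Sorted u → Rotation t g a → Rotation u g a → t ≡ u
      rotation-unique _ _ (inj₁ refl)        (inj₁ refl)        = refl
      rotation-unique _ _ (inj₂ (inj₁ refl)) (inj₂ (inj₁ refl)) = refl
      rotation-unique _ _ (inj₂ (inj₂ refl)) (inj₂ (inj₂ refl)) = refl
      rotation-unique (p , q) (r , _) (inj₁ refl)        (inj₂ (inj₁ refl)) = ⊥-elim (<-asym (<-trans p q) r)
      rotation-unique (p , q) (_ , r) (inj₁ refl)        (inj₂ (inj₂ refl)) = ⊥-elim (<-asym (<-trans p q) r)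
      rotation-unique (r , _) (p , q) (inj₂ (inj₁ refl)) (inj₁ refl)        = ⊥-elim (<-asym (<-trans p q) r)
      rotation-unique (_ , r) (p , q) (inj₂ (inj₂ refl)) (inj₁ refl)        = ⊥-elim (<-asym (<-trans p q) r)
      rotation-unique (p , q) (r , _) (inj₂ (inj₁ refl)) (inj₂ (inj₂ refl)) = ⊥-elim (<-asym (<-trans p q) r)
      rotation-unique (r , _) (p , q) (inj₂ (inj₂ refl)) (inj₂ (inj₁ refl)) = ⊥-elim (<-asym (<-trans p q) r)

      lastVertex-injective : ∀ {t u} → t ∈ cellsAt → u ∈ cellsAt → lastVertex t ≡ lastVertex u → t ≡ u
      lastVertex-injective {t} {u} t∈ u∈ eq
        with g , A , rot ← around-cell t∈ | h , B , rot′ ← around-cell u∈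
        rewrite eq | around-unique A B = rotation-unique (cellsAt-sorted t∈) (cellsAt-sorted u∈) rot rot′

      cell-around : ∀ {g a} → Around g a → ∃[ t ] t ∈ cellsAt × lastVertex t ≡ a
      cell-around {g} {a} (around ρ<g g<a a<ρ+n Xg ga Xa) with turn g | turn a
      ... | low g≤N | low a≤N =
        (X , V g , V a) ,
        cellsAt⁺ (inj₁ refl) (subst (ρ <_) (sym Vg≡g) ρ<g) (subst₂ _<_ (sym Vg≡g) (sym Va≡a) g<a) (Xg , ga , Xa) ,
        trans (lastVertex-first (V g) (V a)) Va≡a
        where
        Vg≡g = toℕ-V-< (s≤s g≤N)
        Va≡a = toℕ-V-< (s≤s a≤N)
      ... | low g≤N | high a′ =
        (V (n + a′) , X , V g) ,
        cellsAt⁺ (inj₂ (inj₁ refl)) Va<X (subst (ρ <_) (sym (toℕ-V-< (s≤s g≤N))) ρ<g) (edge-sym Xa , Xg , edge-sym ga) ,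
        trans (lastVertex-second (V g) Va<X) (cong (n +_) Va≡a)
        where
        a′<ρ = +-cancelˡ-< n a′ ρ a<ρ+n
        Va≡a : toℕ (V (n + a′)) ≡ a′
        Va≡a = trans (cong toℕ (V-+n a′)) (toℕ-V-< (<-trans a′<ρ ρ<n))
        Va<X = subst (_< ρ) (sym Va≡a) a′<ρ
      ... | high g′ | high a′ =
        (V (n + g′) , V (n + a′) , X) ,
        cellsAt⁺ (inj₂ (inj₂ refl)) Vg<Va Va<X (ga , edge-sym Xa , edge-sym Xg) ,
        trans (lastVertex-third Vg<Va Va<X) (cong (n +_) Va≡a)
        where
        a′<ρ = +-cancelˡ-< n a′ ρ a<ρ+n
        g′<a′ = +-cancelˡ-< n g′ a′ g<a
        Va≡a : toℕ (V (n + a′)) ≡ a′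
        Va≡a = trans (cong toℕ (V-+n a′)) (toℕ-V-< (<-trans a′<ρ ρ<n))
        Vg≡g : toℕ (V (n + g′)) ≡ g′
        Vg≡g = trans (cong toℕ (V-+n g′)) (toℕ-V-< (<-trans g′<a′ (<-trans a′<ρ ρ<n)))
        Va<X = subst (_< ρ) (sym Va≡a) a′<ρ
        Vg<Va = subst₂ _<_ (sym Vg≡g) (sym Va≡a) g′<a′
      ... | high g′ | low a≤N = ⊥-elim (<⇒≱ g<a (≤-trans a≤N (m≤n⇒m≤1+n (m≤m+n N g′))))

      joinedTo? : Decidable (λ a → Edge T X (V a))
      joinedTo? a = edge? T X (V a)

      -- A last vertex comes at least two steps after X, since the middle vertex of the cell lies in
      -- between.
      position : ℕ → ℕ
      position t = ρ + (2 + t)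

      neighbours : List ℕ
      neighbours = filter joinedTo? (map position (upTo (N ∸ 1)))

      neighbours-unique : Unique neighbours
      neighbours-unique = Unique.filter⁺ joinedTo? (Unique.map⁺
        (λ eq → +-cancelˡ-≡ 2 _ _ (+-cancelˡ-≡ ρ _ _ eq)) (Unique.upTo⁺ (N ∸ 1)))

      1+[N∸1]≡N : suc (N ∸ 1) ≡ N
      1+[N∸1]≡N = m+[n∸m]≡n (≤-trans (s≤s z≤n) 2≤N)

      neighbours⁺ : ∀ {g a} → Around g a → a ∈ neighbours
      neighbours⁺ {g} {a} (around ρ<g g<a a<ρ+n _ _ Xa)
        with t , refl ← m≤n⇒∃[o]m+o≡n (≤-trans (s≤s ρ<g) g<a) =
        ∈-filter⁺ joinedTo? (subst (_∈ map position (upTo (N ∸ 1))) position≡ (∈-map⁺ position (∈-upTo⁺ t<N∸1))) Xa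
        where
        position≡ : position t ≡ suc (suc ρ) + t
        position≡ = trans (+-suc ρ (suc t)) (cong suc (+-suc ρ t))
        t<N∸1 : t < N ∸ 1
        t<N∸1 = +-cancelˡ-< (suc (suc ρ)) t (N ∸ 1) (subst (suc (suc ρ) + t <_)
          (trans (+-comm n ρ) (trans (cong (λ z → ρ + suc z) (sym 1+[N∸1]≡N))
            (trans (+-suc ρ (suc (N ∸ 1))) (cong suc (+-suc ρ (N ∸ 1)))))) a<ρ+n)

      neighbours⁻ : ∀ {a} → a ∈ neighbours → ∃[ g ] Around g a
      neighbours⁻ a∈ with a∈positions , Xa ← ∈-filter⁻ joinedTo? {xs = map position (upTo (N ∸ 1))} a∈
        with t , t∈ , refl ← ∈-map⁻ position a∈positions
        with g , ρ<g , g<a , ρg , ga ← ~-apex {ρ} {position t}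
          (subst (suc ρ <_) (sym (+-suc ρ (suc t))) (s≤s (subst (ρ <_) (sym (+-suc ρ t)) (s≤s (m≤m+n ρ t)))))
          (subst (position t <_) (+-comm ρ n) (+-monoʳ-< ρ (s≤s (subst (suc t <_) 1+[N∸1]≡N (s≤s (∈-upTo⁻ t∈))))))
          (≤-trans ρ<n (m≤m+n n n)) (subst (λ Z → Edge T Z (V (position t))) (sym (V-toℕ X)) Xa) =
        g , around ρ<g g<a
          (subst (position t <_) (+-comm ρ n) (+-monoʳ-< ρ (s≤s (subst (suc t <_) 1+[N∸1]≡N (s≤s (∈-upTo⁻ t∈))))))
          (subst (λ Z → Edge T Z (V g)) (V-toℕ X) ρg) ga Xa

      -- A cell at X is determined by its last vertex, and every edge from X except the side to the
      -- next vertex is the closing side of a cell.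
      cells≡neighbours : length cellsAt ≡ length neighbours
      cells≡neighbours = trans (sym (length-map lastVertex cellsAt))
        (↭-length (∼bag⇒↭ (unique∧set⇒bag
          (unique-map lastVertex-injective cellsAt-unique) neighbours-unique (mk⇔ to from))))
        where
        to : ∀ {a} → a ∈ map lastVertex cellsAt → a ∈ neighbours
        to a∈ with t , t∈ , refl ← ∈-map⁻ lastVertex a∈ with _ , A , _ ← around-cell t∈ = neighbours⁺ A
        from : ∀ {a} → a ∈ neighbours → a ∈ map lastVertex cellsAt
        from a∈ with _ , A ← neighbours⁻ a∈ with t , t∈ , refl ← cell-around A = ∈-map⁺ lastVertex t∈

      degree : ℕ
      degree = ∑< n (λ t → δ X (V t))

      degree-from : ∀ p → ∑ 0 n (λ t → δ X (V (p + t))) ≡ degree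
      degree-from p = trans (∑-def 0 n _) (∑<-periodic n (λ t → δ X (V t)) (λ t → cong (δ X) (V-+n t)) p)

      -- Among the neighbours at positions ρ + 2, ..., ρ + N only the last is joined to X by a
      -- polygon side; it accounts for the extra 1.
      cellsAt-degree : length cellsAt ≡ suc degree
      cellsAt-degree = begin
        length cellsAt                                        ≡⟨ cells≡neighbours ⟩
        length neighbours                                     ≡⟨ length-filter-map-upTo joinedTo? position (N ∸ 1) ⟩
        ∑< (N ∸ 1) (λ t → edge (2 + t))                       ≡⟨ ∑-def 2 n edge ⟨
        ∑ 2 n edge                                            ≡⟨ ∑-last edge 2≤N ⟩
        ∑ 2 N edge + edge N                                   ≡⟨ cong₂ _+_ (∑-cong edge≡e) edge-N ⟩
        ∑ 2 N (e 0) + 1                                       ≡⟨ +-comm _ 1 ⟩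
        suc (∑ 2 N (e 0))                                     ≡⟨ cong suc sides ⟨
        suc (∑ 0 n (e 0))                                     ≡⟨ cong suc (∑-cong λ _ _ → cong (λ Z → δ Z (V (ρ + _))) Vρ) ⟩
        suc (∑ 0 n (λ t → δ X (V (ρ + t))))                   ≡⟨ cong suc (degree-from ρ) ⟩
        suc degree                                            ∎
        where
        open ≡-Reasoning
        open Window (window ρ<n)
        edge = λ t → ind (joinedTo? (ρ + t))
        Vρ : V (ρ + 0) ≡ X
        Vρ = trans (cong V (+-identityʳ ρ)) (V-toℕ X)
        edge-N : edge N ≡ 1
        edge-N = ind-yes (joinedTo? (ρ + N)) (subst (λ Z → Edge T Z (V (ρ + N))) Vρ base)
        edge≡e : ∀ {t} → 2 ≤ t → t < N → edge t ≡ e 0 t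
        edge≡e {t} 2≤t t<N with e-edge (<-trans (s≤s z≤n) 2≤t) (<⇒≤ t<N)
        ... | inj₂ (0t≡1 , 0t) = trans
          (ind-yes (joinedTo? (ρ + t)) (subst (λ Z → Edge T Z (V (ρ + t))) Vρ 0t)) (sym 0t≡1)
        ... | inj₁ 0t≡0 = trans
          (ind-no (joinedTo? (ρ + t)) λ Xt → 0≢1+n (trans (sym 0t≡0)
            (e-chord 2≤t (<⇒≤ t<N) (inj₂ t<N) (subst (λ Z → Edge T Z (V (ρ + t))) (sym Vρ) Xt))))
          (sym 0t≡0)
        sides : ∑ 0 n (e 0) ≡ ∑ 2 N (e 0)
        sides = begin
          ∑ 0 n (e 0)                        ≡⟨ ∑-first (e 0) (s≤s z≤n) ⟩
          e 0 0 + ∑ 1 n (e 0)                ≡⟨ cong₂ _+_ (e-self 0) (∑-first (e 0) (s≤s (≤-trans (s≤s z≤n) 2≤N))) ⟩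
          e 0 1 + ∑ 2 n (e 0)                ≡⟨ cong₂ _+_ (e-side (≤-trans (s≤s z≤n) 2≤N)) (∑-last (e 0) 2≤N) ⟩
          ∑ 2 N (e 0) + e 0 N                ≡⟨ cong (∑ 2 N (e 0) +_) e-base ⟩
          ∑ 2 N (e 0) + 0                    ≡⟨ +-identityʳ _ ⟩
          ∑ 2 N (e 0)                        ∎

    quiddity-degree : ∀ u → quiddity T u ≡ suc (degree (v u))
    quiddity-degree u = cellsAt-degree (v u)

-- Solutions of the quiddity recurrence along the cells

module Recurrences where
  open import Data.Integer using (ℤ; +_; 0ℤ; 1ℤ)
  open import Data.Nat using (_+_; _<_; _≤_)
  open import Data.Nat.Properties
  open Sums
  open Windows

  -- The cells under v_b v_a having v_b, respectively v_a, as a vertex: they form the left and the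
  -- right spine of the tree.
  lcells rcells : ∀ {E b a} → Tree E b a → ℕ
  lcells (leaf _)     = 0
  lcells (node _ l _) = suc (lcells l)
  rcells (leaf _)     = 0
  rcells (node _ _ r) = suc (rcells r)

  module Recurrence {N : ℕ} (win : Window N) (c : ℕ → ℕ)
    (c-chords : ∀ {g} → 0 < g → g < N → c g ≡ suc (∑ 0 (suc N) (Window.e win g)))
    (x : ℕ → ℤ) (x-rec : ∀ t → x (suc (suc t)) ≡ + c (suc t) ℤ.* x (suc t) ℤ.- x t)
    where
    open Window win

    -- Each cell on the spine contributes its base side, and no other diagonal leaves v_b below v_a.
    -- The disjunction excludes the base edge, which is not a diagonal.
    lcells-chords : ∀ {b a} (t : Tree E b a) → a ≤ N → 0 < b ⊎ a < N →
      lcells t ≡ ∑ (suc b) (suc a) (e b)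
    lcells-chords {b} (leaf _) a≤N _ = sym (trans (∑-single (suc b) (e b)) (e-side a≤N))
    lcells-chords {b} {a} (node {g = g} ba l r) a≤N proper = sym (begin
      ∑ (suc b) (suc a) (e b)              ≡⟨ ∑-last (e b) (<-trans b<g g<a) ⟩
      ∑ (suc b) a (e b) + e b a
        ≡⟨ cong₂ _+_ (∑-split (e b) (m≤n⇒m≤1+n b<g) g<a) (e-chord (≤-trans (s≤s b<g) g<a) a≤N proper ba) ⟩
      ∑ (suc b) (suc g) (e b) + ∑ (suc g) a (e b) + 1
        ≡⟨ cong₂ (λ y z → y + z + 1) (sym (lcells-chords l (<⇒≤ g<N) (inj₂ g<N)))
             (∑-zero λ g<y y<a → e-crossingˡ b<g g<y y<a a≤N (tree-edge r)) ⟩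
      lcells l + 0 + 1                     ≡⟨ +-comm (lcells l + 0) 1 ⟩
      suc (lcells l + 0)                   ≡⟨ cong suc (+-identityʳ _) ⟩
      suc (lcells l)                       ∎)
      where
      open ≡-Reasoning
      b<g = tree-< l
      g<a = tree-< r
      g<N = <-≤-trans g<a a≤N

    rcells-chords : ∀ {b a} (t : Tree E b a) → a ≤ N → 0 < b ⊎ a < N →
      rcells t ≡ ∑ b a (λ y → e y a)
    rcells-chords {b} (leaf _) a≤N _ = sym (trans (∑-single b _) (e-side a≤N))
    rcells-chords {b} {a} (node {g = g} ba l r) a≤N proper = sym (begin
      ∑ b a f                                  ≡⟨ ∑-first f (<-trans b<g g<a) ⟩
      e b a + ∑ (suc b) a f
        ≡⟨ cong₂ _+_ (e-chord (≤-trans (s≤s b<g) g<a) a≤N proper ba) (∑-split f b<g (<⇒≤ g<a)) ⟩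
      1 + (∑ (suc b) g f + ∑ g a f)
        ≡⟨ cong₂ (λ y z → 1 + (y + z)) (∑-zero λ b<y y<g → e-crossingʳ b<y y<g g<a a≤N (tree-edge l))
             (sym (rcells-chords r a≤N (inj₁ (≤-<-trans z≤n b<g)))) ⟩
      suc (rcells r)                           ∎)
      where
      open ≡-Reasoning
      f = λ y → e y a
      b<g = tree-< l
      g<a = tree-< r

    c-cells : ∀ {b g a} → E b a → (l : Tree E b g) (r : Tree E g a) → a ≤ N →
      c g ≡ suc (rcells l + lcells r)
    c-cells {b} {g} {a} ba l r a≤N = trans (c-chords 0<g g<N) (cong suc (begin
      ∑ 0 (suc N) f
        ≡⟨ ∑-split f z≤n (m≤n⇒m≤1+n (<⇒≤ g<N)) ⟩
      ∑ 0 g f + ∑ g (suc N) f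
        ≡⟨ cong₂ _+_ (∑-split f z≤n (<⇒≤ b<g)) (∑-first f (m≤n⇒m≤1+n g<N)) ⟩
      ∑ 0 b f + ∑ b g f + (e g g + ∑ (suc g) (suc N) f)
        ≡⟨ cong₂ (λ y z → y + ∑ b g f + z) (∑-zero λ _ y<b → trans (e-sym g _) (e-crossingˡ y<b b<g g<a a≤N ba))
             (cong₂ _+_ (e-self g) (∑-split f (s≤s (<⇒≤ g<a)) (s≤s a≤N))) ⟩
      ∑ b g f + (∑ (suc g) (suc a) f + ∑ (suc a) (suc N) f)
        ≡⟨ cong₂ (λ y z → y + (∑ (suc g) (suc a) f + z)) (∑-cong λ _ _ → e-sym g _)
             (∑-zero λ { a<y (s≤s y≤N) → e-crossingʳ b<g g<a a<y y≤N ba }) ⟩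
      ∑ b g (λ y → e y g) + (∑ (suc g) (suc a) f + 0)
        ≡⟨ cong₂ _+_ (sym (rcells-chords l (<⇒≤ g<N) (inj₂ g<N)))
             (trans (+-identityʳ _) (sym (lcells-chords r a≤N (inj₁ 0<g)))) ⟩
      rcells l + lcells r ∎))
      where
      open ≡-Reasoning
      f = e g
      b<g = tree-< l
      g<a = tree-< r
      g<N = <-≤-trans g<a a≤N
      0<g = ≤-<-trans z≤n b<g

    private
      solve-apex : ∀ l r X A B → l ℤ.* X ℤ.+ A ≡ (1ℤ ℤ.+ (r ℤ.+ l)) ℤ.* X ℤ.- (r ℤ.* X ℤ.+ B) → X ≡ A ℤ.+ B
      solve-apex l r X A B eq = trans (rearrange l r X B)
        (trans (cong (λ z → z ℤ.+ B ℤ.- l ℤ.* X) (sym eq)) (cancel (l ℤ.* X) A B))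
        where
        rearrange : ∀ l r X B → X ≡ (1ℤ ℤ.+ (r ℤ.+ l)) ℤ.* X ℤ.- (r ℤ.* X ℤ.+ B) ℤ.+ B ℤ.- l ℤ.* X
        rearrange = ℤ.solve-∀
        cancel : ∀ Z A B → Z ℤ.+ A ℤ.+ B ℤ.- Z ≡ A ℤ.+ B
        cancel = ℤ.solve-∀

      push : ∀ l {b g a y} → y ≡ l ℤ.* b ℤ.+ g → g ≡ a ℤ.+ b → y ≡ (1ℤ ℤ.+ l) ℤ.* b ℤ.+ a
      push l {b} {a = a} y≡ g≡ = trans y≡ (trans (cong (ℤ._+_ (l ℤ.* b)) g≡) (collect l b a))
        where
        collect : ∀ l b a → l ℤ.* b ℤ.+ (a ℤ.+ b) ≡ (1ℤ ℤ.+ l) ℤ.* b ℤ.+ a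
        collect = ℤ.solve-∀

      0*-+ : ∀ y z → z ≡ 0ℤ ℤ.* y ℤ.+ z
      0*-+ = ℤ.solve-∀

    -- Eliminating the inner vertices of a triangulated interval one cell at a
    -- time expresses the neighbours of its ends through the two ends.
    next : ∀ {b a} (t : Tree E b a) → a ≤ N → x (suc b) ≡ + lcells t ℤ.* x b ℤ.+ x a
    prev : ∀ {b p} (t : Tree E b (suc p)) → suc p ≤ N → x p ≡ + rcells t ℤ.* x (suc p) ℤ.+ x b
    apex : ∀ {b g a} → E b a → Tree E b g → Tree E g a → a ≤ N → x g ≡ x a ℤ.+ x b

    apex {g = zero}  ba l r a≤N with () ← tree-< l
    apex {b} {suc p} {a} ba l r a≤N =
      solve-apex (+ lcells r) (+ rcells l) (x (suc p)) (x a) (x b) (begin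
        + lcells r ℤ.* x (suc p) ℤ.+ x a            ≡⟨ next r a≤N ⟨
        x (suc (suc p))                             ≡⟨ x-rec p ⟩
        + c (suc p) ℤ.* x (suc p) ℤ.- x p           ≡⟨ cong₂ (λ y z → + y ℤ.* x (suc p) ℤ.- z)
                                                        (c-cells ba l r a≤N) (prev l (≤-trans (<⇒≤ (tree-< r)) a≤N)) ⟩
        (1ℤ ℤ.+ (+ rcells l ℤ.+ + lcells r)) ℤ.* x (suc p) ℤ.- (+ rcells l ℤ.* x (suc p) ℤ.+ x b) ∎)
      where open ≡-Reasoning

    next (leaf {b} _) _ = 0*-+ (x b) (x (suc b))
    next {b} {a} (node ba l r) a≤N =
      push (+ lcells l) (next l (≤-trans (<⇒≤ (tree-< r)) a≤N)) (apex ba l r a≤N)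

    prev (leaf {b} _) _ = 0*-+ (x (suc b)) (x b)
    prev {b} {p} (node ba l r) a≤N =
      push (+ rcells r) (prev r a≤N) (trans (apex ba l r a≤N) (ℤ.+-comm (x (suc p)) (x b)))

    module _ (2≤N : 2 ≤ N) (x-0 : x 0 ≡ 0ℤ) (x-1 : x 1 ≡ 1ℤ) where

      -- As x 0 = 0, the multiple of `x b` in `next` vanishes at b = 0, leaving x 1 = x y.
      edge⇒one : ∀ {y} → 0 < y → y ≤ N → E 0 y → x y ≡ 1ℤ
      edge⇒one {y} 0<y y≤N 0y = sym (begin
        1ℤ                                ≡⟨ x-1 ⟨
        x 1                               ≡⟨ next t y≤N ⟩
        + lcells t ℤ.* x 0 ℤ.+ x y        ≡⟨ cong (λ z → + lcells t ℤ.* z ℤ.+ x y) x-0 ⟩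
        + lcells t ℤ.* 0ℤ ℤ.+ x y         ≡⟨ cong (ℤ._+ x y) (ℤ.*-zeroʳ (+ lcells t)) ⟩
        0ℤ ℤ.+ x y                        ≡⟨ ℤ.+-identityˡ _ ⟩
        x y                               ∎)
        where
        open ≡-Reasoning
        t = tree 0<y y≤N 0y

      Positive : ℕ → Set
      Positive y = 1ℤ ℤ.≤ x y × (x y ≡ 1ℤ → E 0 y)

      -- An apex over a base side at v_0 copies the entry of `a` and is joined to v_0 by its own
      -- cell; any other apex has an entry that is a sum of two entries at least 1, so it exceeds 1.
      positive : ∀ {y} → 0 < y → y ≤ N → Positive y
      positive {y} 0<y y≤N with tree-induction P (λ _ _ → ⊤) step (tree 0<N ≤-refl base) ≤-refl tt
          (inj₁ refl) (inj₂ (ℤ.≤-reflexive (sym (edge⇒one 0<N ≤-refl base)) , λ _ → base)) y z≤n y≤N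
        where
        0<N = ≤-trans (s≤s z≤n) 2≤N
        P : ℕ → Set
        P y = y ≡ 0 ⊎ Positive y
        step : ∀ {b g a} → b < g → g < a → a ≤ N → E b g → E g a → E b a →
          ⊤ → P b → P a → P g × ⊤ × ⊤
        step {a = a} b<g g<a a≤N bg ga ba _ pb (inj₁ refl) with () ← g<a
        step {b} {g} {a} b<g g<a a≤N bg ga ba _ (inj₁ refl) (inj₂ (xa≥1 , _)) =
          inj₂ (subst (1ℤ ℤ.≤_) (sym xg≡xa) xa≥1 , λ _ → bg) , _
          where
          xg≡xa : x g ≡ x a
          xg≡xa = trans (apex ba (tree b<g (≤-trans (<⇒≤ g<a) a≤N) bg) (tree g<a a≤N ga) a≤N)
            (trans (cong (ℤ._+_ (x a)) x-0) (ℤ.+-identityʳ _))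
        step {b} {g} {a} b<g g<a a≤N bg ga ba _ (inj₂ (xb≥1 , _)) (inj₂ (xa≥1 , _)) =
          inj₂ (ℤ.≤-trans (ℤ.+≤+ (s≤s z≤n)) xg≥2 , λ xg≡1 → ⊥-elim (2≰1 (subst (+ 2 ℤ.≤_) xg≡1 xg≥2))) , _
          where
          2≰1 : + 2 ℤ.≤ 1ℤ → ⊥
          2≰1 (ℤ.+≤+ (s≤s ()))
          xg≥2 : + 2 ℤ.≤ x g
          xg≥2 = subst (+ 2 ℤ.≤_)
            (sym (apex ba (tree b<g (≤-trans (<⇒≤ g<a) a≤N) bg) (tree g<a a≤N ga) a≤N))
            (ℤ.+-mono-≤ xa≥1 xb≥1)
      ... | inj₁ refl with () ← 0<y
      ... | inj₂ p = p

      -- The bounds leave out y = 1 and y = N, where the entry is 1 but v_0 v_y is a polygon side.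
      ind-one : ∀ {y} → 2 ≤ y → y < N → ind (x y ℤ.≟ 1ℤ) ≡ e 0 y
      ind-one {y} 2≤y y<N with x y ℤ.≟ 1ℤ
      ... | yes xy≡1 = sym (e-chord 2≤y (<⇒≤ y<N) (inj₂ y<N)
        (proj₂ (positive (<-trans (s≤s z≤n) 2≤y) (<⇒≤ y<N)) xy≡1))
      ... | no  xy≢1 with e-edge {0} (<-trans (s≤s z≤n) 2≤y) (<⇒≤ y<N)
      ...   | inj₁ 0y≡0      = sym 0y≡0
      ...   | inj₂ (_ , 0y)  = ⊥-elim (xy≢1 (edge⇒one (<-trans (s≤s z≤n) 2≤y) (<⇒≤ y<N) 0y))

-- Integer ranges as sums, and double counting of the ends of diagonals

module Ranges where
  open import Data.Integer using (ℤ; +_; 0ℤ; 1ℤ)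
  open import Data.Nat using (_+_; _∸_; _<_; _≤_)
  open import Data.Nat.Properties
  open Sums
  open Windows

  range-length : ∀ lo hi → ℤ.∣ 0ℤ ℤ.⊔ (+ hi ℤ.- + lo) ∣ ≡ hi ∸ lo
  range-length lo hi with ≤-total lo hi
  ... | inj₁ lo≤hi rewrite ℤ.m-n≡m⊖n hi lo | ℤ.⊖-≥ lo≤hi = refl
  ... | inj₂ hi≤lo rewrite ℤ.m-n≡m⊖n hi lo | ℤ.⊖-≤ hi≤lo | m≤n⇒m∸n≡0 hi≤lo =
    cong ℤ.∣_∣ (ℤ.i≥j⇒i⊔j≡i (ℤ.neg-≤-pos {lo ∸ hi} {0}))

  -- The integers k, …, ℓ are i + lo, …, i + hi - 1, so that sums over them become ∑ lo hi.
  record Spans (i k ℓ : ℤ) (lo hi : ℕ) : Set where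
    constructor spans
    field
      start : k ≡ i ℤ.+ + lo
      end   : ℓ ℤ.+ 1ℤ ≡ i ℤ.+ + hi

  range-map : ∀ {i k ℓ lo hi} → Spans i k ℓ lo hi →
    range k ℓ ≡ map (λ t → i ℤ.+ + lo ℤ.+ + t) (upTo (hi ∸ lo))
  range-map {i} {k} {ℓ} {lo} {hi} (spans refl end) = cong (λ m → map (λ t → i ℤ.+ + lo ℤ.+ + t) (upTo m))
    (trans (cong (λ z → ℤ.∣ 0ℤ ℤ.⊔ z ∣)
        (trans (commute ℓ i (+ lo)) (trans (cong (ℤ._- (i ℤ.+ + lo)) end) (cancel i (+ hi) (+ lo)))))
      (range-length lo hi))
    where
    commute : ∀ ℓ i l → ℓ ℤ.- (i ℤ.+ l) ℤ.+ 1ℤ ≡ ℓ ℤ.+ 1ℤ ℤ.- (i ℤ.+ l)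
    commute = ℤ.solve-∀
    cancel : ∀ i h l → i ℤ.+ h ℤ.- (i ℤ.+ l) ≡ h ℤ.- l
    cancel = ℤ.solve-∀

  length-filter-range : ∀ {i k ℓ lo hi} {P : ℤ → Set} (P? : Decidable P) → Spans i k ℓ lo hi →
    length (filter P? (range k ℓ)) ≡ ∑ lo hi (λ t → ind (P? (i ℤ.+ + t)))
  length-filter-range {i} {lo = lo} {hi} P? span =
    trans (cong (length ∘ filter P?) (range-map span))
      (trans (length-filter-map-upTo P? (λ t → i ℤ.+ + lo ℤ.+ + t) (hi ∸ lo))
        (trans (∑<-cong (hi ∸ lo) λ {t} _ → cong (λ z → ind (P? z)) (ℤ.+-assoc i (+ lo) (+ t)))
          (sym (∑-def lo hi _))))

  length-filter-map : {A B : Set} {P : B → Set} (P? : Decidable P) (f : A → B) (xs : List A) →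
    length (filter P? (map f xs)) ≡ length (filter (P? ∘ f) xs)
  length-filter-map P? f []       = refl
  length-filter-map P? f (x ∷ xs) with does (P? (f x))
  ... | true  = cong suc (length-filter-map P? f xs)
  ... | false = length-filter-map P? f xs

  length-filter-product : {P : ℤ × ℤ → Set} (P? : Decidable P) (g : ℕ → ℤ) (m : ℕ) (ys : List ℤ) →
    length (filter P? (cartesianProduct (map g (upTo m)) ys)) ≡
    ∑< m (λ s → length (filter (λ y → P? (g s , y)) ys))
  length-filter-product P? g m ys = go (λ t → t) m
    where
    go : ∀ h m → length (filter P? (cartesianProduct (map g (applyUpTo h m)) ys)) ≡
      ∑< m (λ s → length (filter (λ y → P? (g (h s) , y)) ys))
    go h zero    = refl
    go h (suc m) = trans
      (cong length (filter-++ P? (map (g (h 0) ,_) ys) (cartesianProduct (map g (applyUpTo (h ∘ suc) m)) ys)))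
      (trans (length-++ (filter P? (map (g (h 0) ,_) ys)))
        (cong₂ _+_ (length-filter-map P? (g (h 0) ,_) ys) (go (h ∘ suc) m)))

  length-filter-rectangle : ∀ {i k ℓ lo hi k′ ℓ′ lo′ hi′} {P : ℤ × ℤ → Set} (P? : Decidable P) →
    Spans i k ℓ lo hi → Spans i k′ ℓ′ lo′ hi′ →
    length (filter P? (cartesianProduct (range k ℓ) (range k′ ℓ′))) ≡
    ∑ lo hi (λ x → ∑ lo′ hi′ (λ y → ind (P? (i ℤ.+ + x , i ℤ.+ + y))))
  length-filter-rectangle {i} {lo = lo} {hi} {k′} {ℓ′} {lo′} {hi′} P? span span′ =
    trans (cong (λ xs → length (filter P? (cartesianProduct xs (range k′ ℓ′)))) (range-map span))
      (trans (length-filter-product P? (λ t → i ℤ.+ + lo ℤ.+ + t) (hi ∸ lo) (range k′ ℓ′))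
        (trans (∑<-cong (hi ∸ lo) λ {t} _ →
            trans (length-filter-range (λ y → P? (i ℤ.+ + lo ℤ.+ + t , y)) span′)
              (cong (λ z → ∑ lo′ hi′ (λ y → ind (P? (z , i ℤ.+ + y)))) (ℤ.+-assoc i (+ lo) (+ t))))
          (sym (∑-def lo hi _))))

  sumFromTo-∑ : ∀ {i k ℓ lo hi} (f : ℤ → ℤ) (d : ℕ → ℕ) → Spans i k ℓ lo hi →
    (∀ t → f (i ℤ.+ + t) ≡ + d t) → sumFromTo k ℓ f ≡ + ∑ lo hi d
  sumFromTo-∑ {i} {lo = lo} {hi} f d span f≡d =
    trans (cong (λ xs → foldr ℤ._+_ 0ℤ (map f xs)) (range-map span))
      (trans (go (λ t → t) (hi ∸ lo)) (cong +_ (sym (∑-def lo hi d))))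
    where
    go : ∀ h m → foldr ℤ._+_ 0ℤ (map f (map (λ t → i ℤ.+ + lo ℤ.+ + t) (applyUpTo h m))) ≡
      + ∑< m (λ t → d (lo + h t))
    go h zero    = refl
    go h (suc m) = cong₂ ℤ._+_ (trans (cong f (ℤ.+-assoc i (+ lo) (+ h 0))) (f≡d (lo + h 0))) (go (h ∘ suc) m)

  +-cancelˡ-+≤+ : ∀ i {x y} → i ℤ.+ + x ℤ.≤ i ℤ.+ + y → x ≤ y
  +-cancelˡ-+≤+ i {x} {y} le = ℤ.drop‿+≤+ (subst₂ ℤ._≤_ (cancel i (+ x)) (cancel i (+ y)) (ℤ.+-monoʳ-≤ (ℤ.- i) le))
    where
    cancel : ∀ i x → ℤ.- i ℤ.+ (i ℤ.+ x) ≡ x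
    cancel = ℤ.solve-∀

  offset : ∀ {i k} → i ℤ.≤ k → ∃[ m ] k ≡ i ℤ.+ + m
  offset {i} {k} i≤k = ℤ.∣ k ℤ.- i ∣ , trans (split i k) (cong (ℤ._+_ i) (sym (ℤ.0≤i⇒+∣i∣≡i (ℤ.i≤j⇒0≤j-i i≤k))))
    where
    split : ∀ i k → k ≡ i ℤ.+ (k ℤ.- i)
    split = ℤ.solve-∀

  module Triangles {N : ℕ} (win : Window N) where
    open Window win

    triangle : ℕ → ℕ → ℕ
    triangle lo hi = ∑ lo hi (λ x → ∑ (suc x) hi (e x))

    triangle-last : ∀ {lo g} → lo ≤ g → triangle lo (suc g) ≡ triangle lo g + ∑ lo g (λ x → e x g)
    triangle-last {lo} {g} lo≤g = begin
      triangle lo (suc g)                                  ≡⟨ ∑-last _ lo≤g ⟩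
      ∑ lo g (λ x → ∑ (suc x) (suc g) (e x)) + ∑ (suc g) (suc g) (e g)
        ≡⟨ cong₂ _+_ (∑-cong λ _ x<g → ∑-last (e _) x<g) (∑-empty (suc g) (e g)) ⟩
      ∑ lo g (λ x → ∑ (suc x) g (e x) + e x g) + 0         ≡⟨ +-identityʳ _ ⟩
      ∑ lo g (λ x → ∑ (suc x) g (e x) + e x g)             ≡⟨ ∑-+ lo g _ _ ⟩
      triangle lo g + ∑ lo g (λ x → e x g)                 ∎
      where open ≡-Reasoning

    square : ∀ lo m → ∑ lo (lo + m) (λ x → ∑ lo (lo + m) (e x)) ≡ triangle lo (lo + m) + triangle lo (lo + m)
    square lo zero rewrite +-identityʳ lo = trans (∑-empty lo _) (sym (cong₂ _+_ (∑-empty lo _) (∑-empty lo _)))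
    square lo (suc m) rewrite +-suc lo m = begin
      ∑ lo (suc g) (λ x → ∑ lo (suc g) (e x))
        ≡⟨ ∑-last _ lo≤g ⟩
      ∑ lo g (λ x → ∑ lo (suc g) (e x)) + ∑ lo (suc g) (e g)
        ≡⟨ cong₂ _+_ (trans (∑-cong λ _ _ → ∑-last (e _) lo≤g) (∑-+ lo g _ _))
             (trans (∑-last (e g) lo≤g) (cong (ℕ._+_ (∑ lo g (e g))) (e-self g))) ⟩
      ∑ lo g (λ x → ∑ lo g (e x)) + column + (∑ lo g (e g) + 0)
        ≡⟨ cong₂ (λ y z → y + column + (z + 0)) (square lo m) (∑-cong λ _ _ → e-sym g _) ⟩
      triangle lo g + triangle lo g + column + (column + 0)
        ≡⟨ regroup (triangle lo g) column ⟩
      (triangle lo g + column) + (triangle lo g + column)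
        ≡⟨ cong₂ _+_ (triangle-last lo≤g) (triangle-last lo≤g) ⟨
      triangle lo (suc g) + triangle lo (suc g) ∎
      where
      open ≡-Reasoning
      g = lo + m
      lo≤g = m≤m+n lo m
      column = ∑ lo g (λ x → e x g)
      regroup : ∀ t c → t + t + c + (c + 0) ≡ t + c + (t + c)
      regroup = ℕ.solve-∀

    -- Count ends among lo, ..., g - 1. A diagonal with both ends there counts twice, giving two
    -- copies of `triangle lo g`; one ending at g counts once and enlarges one copy to
    -- `triangle lo (suc g)`; one ending beyond g is counted by `over`.
    degrees : ∀ lo {g} → lo ≤ g → g ≤ N →
      ∑ lo g (λ x → ∑ lo (suc N) (e x)) ≡ triangle lo (suc g) + triangle lo g + over lo g
    degrees lo {g} lo≤g g≤N with m , refl ← m≤n⇒∃[o]m+o≡n lo≤g = begin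
      ∑ lo g (λ x → ∑ lo (suc N) (e x))
        ≡⟨ ∑-cong (λ {x} _ _ → trans (∑-split (e x) lo≤g (m≤n⇒m≤1+n g≤N))
             (cong (ℕ._+_ (∑ lo g (e x))) (∑-first (e x) (s≤s g≤N)))) ⟩
      ∑ lo g (λ x → ∑ lo g (e x) + (e x g + ∑ (suc g) (suc N) (e x)))
        ≡⟨ trans (∑-+ lo g _ _) (cong₂ _+_ (square lo m) (∑-+ lo g _ _)) ⟩
      triangle lo g + triangle lo g + (∑ lo g (λ x → e x g) + over lo g)
        ≡⟨ regroup (triangle lo g) _ (over lo g) ⟩
      triangle lo g + ∑ lo g (λ x → e x g) + triangle lo g + over lo g
        ≡⟨ cong (λ z → z + triangle lo g + over lo g) (triangle-last lo≤g) ⟨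
      triangle lo (suc g) + triangle lo g + over lo g ∎
      where
      open ≡-Reasoning
      regroup : ∀ t c o → t + t + (c + o) ≡ t + c + t + o
      regroup = ℕ.solve-∀

    -- The diagonals back to v_0 form the missing first row of `triangle 0 g`. Hence the two
    -- triangles in the denominator formula start at different indices.
    degrees₁ : ∀ {g} → 1 ≤ g → g ≤ N →
      ∑ 1 g (λ x → ∑ 0 (suc N) (e x)) ≡ triangle 1 (suc g) + triangle 0 g + over 1 g
    degrees₁ {g} 1≤g g≤N = begin
      ∑ 1 g (λ x → ∑ 0 (suc N) (e x))
        ≡⟨ trans (∑-cong λ _ _ → ∑-first (e _) (s≤s z≤n)) (∑-+ 1 g _ _) ⟩
      ∑ 1 g (λ x → e x 0) + ∑ 1 g (λ x → ∑ 1 (suc N) (e x))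
        ≡⟨ cong₂ _+_ (∑-cong λ _ _ → e-sym _ 0) (degrees 1 1≤g g≤N) ⟩
      ∑ 1 g (e 0) + (triangle 1 (suc g) + triangle 1 g + over 1 g)
        ≡⟨ regroup (∑ 1 g (e 0)) (triangle 1 (suc g)) (triangle 1 g) (over 1 g) ⟩
      triangle 1 (suc g) + (∑ 1 g (e 0) + triangle 1 g) + over 1 g
        ≡⟨ cong (λ z → triangle 1 (suc g) + z + over 1 g) (∑-first _ 1≤g) ⟨
      triangle 1 (suc g) + triangle 0 g + over 1 g ∎
      where
      open ≡-Reasoning
      regroup : ∀ a b c d → a + (b + c + d) ≡ b + (a + c) + d
      regroup = ℕ.solve-∀

    -- Separating the diagonals that end at v_N gives the two counts in the second formula for the
    -- degree of a numerator.
    over-fan : ∀ {g} → g < N → over 0 g ≡ fan g + ∑ 0 g (λ x → ∑ (suc g) N (e x))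
    over-fan {g} g<N = trans (trans (∑-cong λ _ _ → ∑-last (e _) g<N) (∑-+ 0 g _ _)) (+-comm _ (fan g))

-- Extreme coefficients of the Farey labels

module Labels where
  open import Data.Integer using (ℤ; +_; 0ℤ; 1ℤ; -1ℤ)
  open import Data.Nat using (_+_; _<_; _≤_)
  open import Data.Nat.Properties
  open Sums
  open Windows

  coeff-⊕ : ∀ f g d → coeff (f ⊕ g) d ≡ coeff f d ℤ.+ coeff g d
  coeff-⊕ []      g       d       = sym (ℤ.+-identityˡ _)
  coeff-⊕ (x ∷ f) []      d       = sym (ℤ.+-identityʳ _)
  coeff-⊕ (x ∷ f) (y ∷ g) zero    = refl
  coeff-⊕ (x ∷ f) (y ∷ g) (suc d) = coeff-⊕ f g d

  coeff-q^-≥ : ∀ k f d → coeff (q^ k · f) (k + d) ≡ coeff f d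
  coeff-q^-≥ zero    f d = refl
  coeff-q^-≥ (suc k) f d = coeff-q^-≥ k f d

  coeff-q^-< : ∀ k f {d} → d < k → coeff (q^ k · f) d ≡ 0ℤ
  coeff-q^-< (suc k) f {zero}  _         = refl
  coeff-q^-< (suc k) f {suc d} (s≤s d<k) = coeff-q^-< k f d<k

  Above Below : Poly → ℕ → Set
  Above f d = ∀ {e} → d ≤ e → coeff f e ≡ 0ℤ
  Below f d = ∀ {e} → e < d → coeff f e ≡ 0ℤ

  -- The extreme coefficients of all labels are 1.
  Top Bot : Poly → ℕ → Set
  Top f d = coeff f d ≡ 1ℤ × Above f (suc d)
  Bot f d = coeff f d ≡ 1ℤ × Below f d

  1≢0 : 1ℤ ≢ 0ℤ
  1≢0 ()

  Top⇒IsDeg : ∀ f {d} → Top f d → IsDeg f d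
  Top⇒IsDeg f {d} (top , above) =
    (λ f≡0 → 1≢0 (trans (sym top) f≡0)) ,
    λ e f≢0 → ≮⇒≥ λ d<e → f≢0 (above d<e)

  Bot⇒IsDegMin : ∀ f {d} → Bot f d → IsDegMin f d
  Bot⇒IsDegMin f {d} (bot , below) =
    (λ f≡0 → 1≢0 (trans (sym bot) f≡0)) ,
    λ e f≢0 → ≮⇒≥ λ e<d → f≢0 (below e<d)

  module _ (h f g : Poly) (k : ℕ) (h≈ : h ≈ f ⊕ q^ k · g) where

    private
      coeff-h : ∀ d → coeff h d ≡ coeff f d ℤ.+ coeff (q^ k · g) d
      coeff-h d = trans (h≈ d) (coeff-⊕ f (q^ k · g) d)

      coeff-h-≥ : ∀ d → coeff h (k + d) ≡ coeff f (k + d) ℤ.+ coeff g d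
      coeff-h-≥ d = trans (coeff-h (k + d)) (cong (ℤ._+_ (coeff f (k + d))) (coeff-q^-≥ k g d))

      coeff-h-< : ∀ {d} → d < k → coeff h d ≡ coeff f d
      coeff-h-< {d} d<k = trans (coeff-h d)
        (trans (cong (ℤ._+_ (coeff f d)) (coeff-q^-< k g d<k)) (ℤ.+-identityʳ _))

    -- The hypothesis on `f` lets the shifted summand alone decide the top coefficient, so no
    -- cancellation can occur.
    Top-shift : ∀ {d} → Top g d → Above f (d + k) → Top h (d + k)
    Top-shift {d} (top , above) f0 rewrite +-comm d k =
      trans (coeff-h-≥ d) (cong₂ ℤ._+_ (f0 ≤-refl) top) , above-h
      where
      above-h : Above h (suc (k + d))
      above-h {e} k+d<e with o , refl ← m≤n⇒∃[o]m+o≡n (≤-trans (m≤n⇒m≤1+n (m≤m+n k d)) k+d<e) =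
        trans (coeff-h-≥ o) (cong₂ ℤ._+_ (f0 (<⇒≤ k+d<e)) (above (+-cancelˡ-< k d o k+d<e)))

    Bot-shift : ∀ {d} → Bot g d → Below f (suc (d + k)) → Bot h (d + k)
    Bot-shift {d} (bot , below) f0 rewrite +-comm d k =
      trans (coeff-h-≥ d) (cong₂ ℤ._+_ (f0 ≤-refl) bot) , below-h
      where
      below-h : Below h (k + d)
      below-h {e} e<k+d with e ℕ.<? k
      ... | yes e<k = trans (coeff-h-< e<k) (f0 (m≤n⇒m≤1+n e<k+d))
      ... | no  e≮k with o , refl ← m≤n⇒∃[o]m+o≡n (≮⇒≥ e≮k) =
        trans (coeff-h-≥ o) (cong₂ ℤ._+_ (f0 (m≤n⇒m≤1+n e<k+d)) (below (+-cancelˡ-< k o d e<k+d)))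

    Bot-⊕ : ∀ {d d′} → Bot g d′ → d < d′ + k → Bot f d → Bot h d
    Bot-⊕ {d} {d′} (_ , below) d< (bot , below-f) =
      trans (agree ≤-refl) bot , λ e<d → trans (agree (<⇒≤ e<d)) (below-f e<d)
      where
      agree : ∀ {e} → e ≤ d → coeff h e ≡ coeff f e
      agree {e} e≤d with e ℕ.<? k
      ... | yes e<k = coeff-h-< e<k
      ... | no  e≮k with o , refl ← m≤n⇒∃[o]m+o≡n (≮⇒≥ e≮k) =
        trans (coeff-h-≥ o) (trans (cong (ℤ._+_ (coeff f (k + o)))
          (below (+-cancelˡ-< k o d′ (≤-<-trans e≤d (subst (d <_) (+-comm d′ k) d<)))))
          (ℤ.+-identityʳ _))

    ⊕-zero : g ≈ 0ᵖ → h ≈ f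
    ⊕-zero g≈0 e with e ℕ.<? k
    ... | yes e<k = coeff-h-< e<k
    ... | no  e≮k with o , refl ← m≤n⇒∃[o]m+o≡n (≮⇒≥ e≮k) =
      trans (coeff-h-≥ o) (trans (cong (ℤ._+_ (coeff f (k + o))) (g≈0 o)) (ℤ.+-identityʳ _))

  Top-≈ : ∀ f g {d} → f ≈ g → Top g d → Top f d
  Top-≈ f g f≈g (top , above) = trans (f≈g _) top , λ d<e → trans (f≈g _) (above d<e)

  Bot-≈ : ∀ f g {d} → f ≈ g → Bot g d → Bot f d
  Bot-≈ f g f≈g (bot , below) = trans (f≈g _) bot , λ e<d → trans (f≈g _) (below e<d)

  Top-1ᵖ : Top 1ᵖ 0
  Top-1ᵖ = refl , λ { (s≤s _) → refl }

  Bot-1ᵖ : Bot 1ᵖ 0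
  Bot-1ᵖ = refl , λ ()

  module Degrees {N : ℕ} (win : Window N) where
    open Window win

    module Extremal (2≤N : 2 ≤ N)
      (r s : ℕ → Poly) (w : ℕ → ℕ → ℤ)
      (w-base : w 0 N ≡ -1ℤ) (r-last : r N ≈ 0ᵖ) (s-last : s N ≈ 1ᵖ)
      (r-first : r 0 ≈ 1ᵖ) (s-first : s 0 ≈ 0ᵖ)
      (rule : ∀ {b g a} ℓ → b < g → g < a → a ≤ N → E b g → E g a → E b a →
        w b a ≡ + ℓ ℤ.- 1ℤ →
        r g ≈ r a ⊕ q^ ℓ · r b × s g ≈ s a ⊕ q^ ℓ · s b × w g a ≡ 0ℤ × w b g ≡ + ℓ)
      where

      -- The numerator at v_N and the denominator at v_0 vanish and have no degree, whence the
      -- guards.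
      record Extremes (x : ℕ) : Set where
        field
          r-top  : x < N → Top (r x) (over 0 x)
          r-bot  : x < N → Bot (r x) (fan x)
          r-zero : x ≡ N → r x ≈ 0ᵖ
          s-top  : 0 < x → Top (s x) (over 1 x)
          s-bot  : 0 < x → Bot (s x) 0
          s-zero : x ≡ 0 → s x ≈ 0ᵖ
      open Extremes

      -- Polygon sides are left out: they are never base sides of cells below, and the weight q^ℓ of
      -- a side v_b v_{b+1} is not q^(level - 1), since e vanishes there.
      Weight : ℕ → ℕ → Set
      Weight b a = suc b < a → w b a ≡ + level b a ℤ.- 1ℤ

      -- For numerators q^ℓ r_b wins at the top, and r_a at the bottom unless v_a is the last
      -- vertex, where r_a = 0. For denominators q^ℓ s_b wins at the top and s_a at the bottom
      -- unless v_b is the first vertex, where s_g = s_a.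
      step : ∀ {b g a} → b < g → g < a → a ≤ N → E b g → E g a → E b a →
        Weight b a → Extremes b → Extremes a → Extremes g × Weight b g × Weight g a
      step {b} {g} {a} b<g g<a a≤N bg ga ba wba eb ea
        with rg , sg , wga , wbg ← rule (level b a) b<g g<a a≤N bg ga ba (wba (≤-trans (s≤s b<g) g<a))
        = record
        { r-top  = λ _ → r-top-g ; r-bot = λ _ → r-bot-g ; r-zero = λ g≡N → ⊥-elim (<⇒≢ g<N g≡N)
        ; s-top  = λ _ → s-top-g (m≤n⇒m<n∨m≡n z≤n) ; s-bot = λ _ → s-bot-g (m≤n⇒m<n∨m≡n z≤n)
        ; s-zero = λ g≡0 → ⊥-elim (<⇒≢ 0<g (sym g≡0)) }
        , (λ 1+b<g → trans wbg (cong (λ z → + z ℤ.- 1ℤ) (sym (level-left 1+b<g))))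
        , (λ 1+g<a → trans wga (cong (λ z → + z ℤ.- 1ℤ) (sym (level-right 1+g<a))))
        where
        open Window.Cell win b<g g<a a≤N bg ga ba
        ℓ = level b a
        g<N = <-≤-trans g<a a≤N
        b<N = <-trans b<g g<N
        0<g = ≤-<-trans z≤n b<g
        0<a = <-trans 0<g g<a
        1+b<a = ≤-trans (s≤s b<g) g<a

        chord : 0 < b ⊎ a < N → e b a ≡ 1
        chord proper = e-chord 1+b<a a≤N proper ba

        level≥1 : e b a ≡ 1 → 1 ≤ ℓ
        level≥1 ba≡1 = subst (1 ≤_)
          (sym (trans (∑-first (e b) (s≤s a≤N)) (cong (_+ ∑ (suc a) (suc N) (e b)) ba≡1))) (s≤s z≤n)

        r-top-g : Top (r g) (over 0 g)
        r-top-g = subst (Top (r g)) (sym (over-apex z≤n))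
          (Top-shift (r g) (r a) (r b) ℓ rg (r-top eb b<N) above)
          where
          above : Above (r a) (over 0 b + ℓ)
          above with m≤n⇒m<n∨m≡n a≤N
          ... | inj₁ a<N = λ d≤e → proj₂ (r-top ea a<N)
            (≤-trans (subst (over 0 a <_) (over-apex z≤n) (over-< z≤n (chord (inj₂ a<N)))) d≤e)
          ... | inj₂ a≡N = λ _ → r-zero ea a≡N _

        r-bot-g : Bot (r g) (fan g)
        r-bot-g with m≤n⇒m<n∨m≡n a≤N
        ... | inj₁ a<N = subst (Bot (r g)) (fan-right a<N)
          (Bot-⊕ (r g) (r a) (r b) ℓ rg (r-bot eb b<N)
            (subst (_< fan b + ℓ) (sym (fan-right a<N)) (fan-< a<N (chord (inj₂ a<N))))
            (r-bot ea a<N))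
        ... | inj₂ a≡N = subst (Bot (r g)) (sym (trans fan-apex (cong (_+_ (fan b)) last)))
          (Bot-shift (r g) (r a) (r b) ℓ rg (r-bot eb b<N) λ _ → r-zero ea a≡N _)
          where
          last : e b N ≡ ℓ
          last = sym (trans (cong (level b) a≡N) (∑-single N (e b)))

        s-top-g : 0 < b ⊎ 0 ≡ b → Top (s g) (over 1 g)
        s-top-g (inj₁ 0<b) = subst (Top (s g)) (sym (over-apex 0<b))
          (Top-shift (s g) (s a) (s b) ℓ sg (s-top eb 0<b) λ d≤e → proj₂ (s-top ea 0<a)
            (≤-trans (subst (over 1 a <_) (over-apex 0<b) (over-< 0<b (chord (inj₁ 0<b)))) d≤e))
        s-top-g (inj₂ refl) with g0 , a0 ← over-base {1} ≤-refl =
          Top-≈ (s g) (s a) (⊕-zero (s g) (s a) (s b) ℓ sg (s-zero eb refl))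
            (subst (Top (s a)) (trans a0 (sym g0)) (s-top ea 0<a))

        s-bot-g : 0 < b ⊎ 0 ≡ b → Bot (s g) 0
        s-bot-g (inj₁ 0<b)  = Bot-⊕ (s g) (s a) (s b) ℓ sg (s-bot eb 0<b) (level≥1 (chord (inj₁ 0<b))) (s-bot ea 0<a)
        s-bot-g (inj₂ refl) = Bot-≈ (s g) (s a) (⊕-zero (s g) (s a) (s b) ℓ sg (s-zero eb refl)) (s-bot ea 0<a)

      extremes : ∀ x → x ≤ N → Extremes x
      extremes x x≤N = tree-induction Extremes Weight step (tree 0<N ≤-refl base) ≤-refl
        -- The base edge has level e 0 N = 0, which explains its weight q^(-1).
        (λ _ → trans w-base (cong (λ z → + z ℤ.- 1ℤ) (sym (trans (∑-single N (e 0)) e-base))))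
        first last x z≤n x≤N
        where
        0<N = ≤-trans (s≤s z≤n) 2≤N
        first : Extremes 0
        first = record
          { r-top = λ _ → Top-≈ (r 0) 1ᵖ r-first (subst (Top 1ᵖ) (sym (∑-empty 0 _)) Top-1ᵖ)
          ; r-bot = λ _ → Bot-≈ (r 0) 1ᵖ r-first (subst (Bot 1ᵖ) (sym (∑-empty 0 _)) Bot-1ᵖ)
          ; r-zero = λ 0≡N → ⊥-elim (<⇒≢ 0<N 0≡N)
          ; s-top = λ () ; s-bot = λ () ; s-zero = λ _ → s-first }
        last : Extremes N
        last = record
          { r-top = λ N<N → ⊥-elim (<-irrefl refl N<N)
          ; r-bot = λ N<N → ⊥-elim (<-irrefl refl N<N)
          ; r-zero = λ _ → r-last
          ; s-top = λ _ → Top-≈ (s N) 1ᵖ s-last (subst (Top 1ᵖ) (sym (∑-zero λ _ _ → ∑-empty (suc N) _)) Top-1ᵖ)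
          ; s-bot = λ _ → Bot-≈ (s N) 1ᵖ s-last Bot-1ᵖ
          ; s-zero = λ N≡0 → ⊥-elim (<⇒≢ 0<N (sym N≡0)) }

-- Ones of the frieze as diagonals

module FriezeEntries where
  open import Data.Integer using (ℤ; +_; 0ℤ; 1ℤ)
  open import Data.Nat using (_+_; _<_; _≤_)
  open import Data.Nat.Properties
  open Sums
  open Windows
  open Residues
  open Polygons
  open Quiddities
  open Recurrences
  open Ranges

  module Friezes (N : ℕ) (2≤N : 2 ≤ N) (T : Triangulation (suc N)) where
    open Geometry N 2≤N T public
    open Quiddity N 2≤N T public

    private
      n = suc N

    residue : ℤ → ℕ
    residue k = k %ℕ n

    windowAt : ℤ → Window N
    windowAt k = window (n%ℕd<d k n)

    at : ∀ k x → v (k ℤ.+ + x) ≡ V (residue k ℕ.+ x)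
    at = v≡V

    δ-at : ∀ k x y → Window.e (windowAt k) x y ≡ δ (v (k ℤ.+ + x)) (v (k ℤ.+ + y))
    δ-at k x y = sym (cong₂ δ (at k x) (at k y))

    quiddity-chords : ∀ k g → quiddity T (k ℤ.+ + g) ≡ suc (∑ 0 n (Window.e (windowAt k) g))
    quiddity-chords k g = trans (quiddity-degree (k ℤ.+ + g)) (cong suc
      (trans (cong degree (at k g)) (sym (degree-from (V (residue k ℕ.+ g)) (residue k)))))

    continuant : ℤ → ℕ → ℤ
    continuant k 0             = 0ℤ
    continuant k 1             = 1ℤ
    continuant k (suc (suc t)) =
      + quiddity T (k ℤ.+ + suc t) ℤ.* continuant k (suc t) ℤ.- continuant k t

    -- The determinant of two solutions of the same second-order recurrence does not change with t,
    -- because the coefficient of x_{t} in it is 1 up to sign; at t = 0 it is 1.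
    continuant-unimodular : ∀ k t →
      continuant k (suc t) ℤ.* continuant (k ℤ.+ 1ℤ) (suc t)
        ℤ.- continuant (k ℤ.+ 1ℤ) t ℤ.* continuant k (suc (suc t)) ≡ 1ℤ
    continuant-unimodular k zero    = cong (ℤ._-_ 1ℤ) (ℤ.*-zeroˡ (continuant k 2))
    continuant-unimodular k (suc t) = trans
      (cong (λ u → D ℤ.* (+ quiddity T u ℤ.* B ℤ.- C) ℤ.- B ℤ.* (c ℤ.* D ℤ.- A)) (ℤ.+-assoc k 1ℤ (+ suc t)))
      (trans (exchange A B C D c) (continuant-unimodular k t))
      where
      A = continuant k (suc t)
      B = continuant (k ℤ.+ 1ℤ) (suc t)
      C = continuant (k ℤ.+ 1ℤ) t
      D = continuant k (suc (suc t))
      c = + quiddity T (k ℤ.+ + suc (suc t))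
      exchange : ∀ A B C D c → D ℤ.* (c ℤ.* B ℤ.- C) ℤ.- B ℤ.* (c ℤ.* D ℤ.- A) ≡ A ℤ.* B ℤ.- C ℤ.* D
      exchange = ℤ.solve-∀

    module AtBase (k : ℤ) where
      open Recurrence (windowAt k) (λ g → quiddity T (k ℤ.+ + g)) (λ {g} _ _ → quiddity-chords k g)
        (continuant k) (λ _ → refl) public

    continuant≥1 : ∀ k {t} → 0 < t → t ≤ N → 1ℤ ℤ.≤ continuant k t
    continuant≥1 k 0<t t≤N = proj₁ (AtBase.positive k 2≤N refl refl 0<t t≤N)

    module _ (F : Frieze T) where
      open Frieze F

      -- The unimodular relation is linear in `σ k ℓ` with coefficient `Z`, positive by
      -- `continuant≥1`; the continuant satisfies the same relation, so `Z` cancels.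
      σ-step : ∀ t k → 3 ℕ.+ t ≤ N →
        σ k (k ℤ.+ + (2 ℕ.+ t)) ≡ continuant k (2 ℕ.+ t) →
        σ (k ℤ.+ 1ℤ) (k ℤ.+ 1ℤ ℤ.+ + (2 ℕ.+ t)) ≡ continuant (k ℤ.+ 1ℤ) (2 ℕ.+ t) →
        σ (k ℤ.+ 1ℤ) (k ℤ.+ 1ℤ ℤ.+ + (1 ℕ.+ t)) ≡ continuant (k ℤ.+ 1ℤ) (1 ℕ.+ t) →
        σ k (k ℤ.+ + (3 ℕ.+ t)) ≡ continuant k (3 ℕ.+ t)
      σ-step t k 3+t≤N σkℓ σk′ℓ σk′ℓ′ =
        ℤ.*-cancelˡ-≡ Z _ _
          {{ℤ.>-nonZero (ℤ.<-≤-trans (ℤ.+<+ (s≤s z≤n)) (continuant≥1 (k ℤ.+ 1ℤ) (s≤s z≤n) 1+t≤N))}}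
          (solve-product (X ℤ.* Y) (Z ℤ.* σ k ℓ) (Z ℤ.* continuant k (3 ℕ.+ t)) (trans (sym unimodular′) unimodular″))
        where
        ℓ = k ℤ.+ + (3 ℕ.+ t)
        2+t≤N = ≤-trans (n≤1+n _) 3+t≤N
        1+t≤N = ≤-trans (n≤1+n _) 2+t≤N
        X = continuant k (2 ℕ.+ t)
        Y = continuant (k ℤ.+ 1ℤ) (2 ℕ.+ t)
        Z = continuant (k ℤ.+ 1ℤ) (1 ℕ.+ t)
        solve-product : ∀ P Q R → P ℤ.- Q ≡ P ℤ.- R → Q ≡ R
        solve-product P Q R eq = trans (recover P Q) (trans (cong (ℤ._-_ P) eq) (sym (recover P R)))
          where
          recover : ∀ P Q → Q ≡ P ℤ.- (P ℤ.- Q)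
          recover = ℤ.solve-∀
        width : ℓ ℤ.- k ≡ + (3 ℕ.+ t)
        width = cancel k (+ (3 ℕ.+ t))
          where
          cancel : ∀ k x → k ℤ.+ x ℤ.- k ≡ x
          cancel = ℤ.solve-∀
        ℓ-1 : ℓ ℤ.- 1ℤ ≡ k ℤ.+ + (2 ℕ.+ t)
        ℓ-1 = ℤ.+-assoc k (+ (3 ℕ.+ t)) (ℤ.- 1ℤ)
        ℓ-1′ : ℓ ℤ.- 1ℤ ≡ k ℤ.+ 1ℤ ℤ.+ + (1 ℕ.+ t)
        ℓ-1′ = trans ℓ-1 (sym (ℤ.+-assoc k 1ℤ (+ (1 ℕ.+ t))))
        ℓ′ : ℓ ≡ k ℤ.+ 1ℤ ℤ.+ + (2 ℕ.+ t)
        ℓ′ = sym (ℤ.+-assoc k 1ℤ (+ (2 ℕ.+ t)))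
        unimodular′ : 1ℤ ≡ X ℤ.* Y ℤ.- Z ℤ.* σ k ℓ
        unimodular′ = trans
          (sym (unimodular k ℓ (subst (+ 3 ℤ.≤_) (sym width) (ℤ.+≤+ (s≤s (s≤s (s≤s z≤n)))))
            (subst (ℤ._≤ + n ℤ.+ 1ℤ) (sym width) (ℤ.+≤+ (≤-trans 3+t≤N (≤-trans (n≤1+n N) (m≤m+n n 1)))))))
          (cong₂ ℤ._-_
            (cong₂ ℤ._*_ (trans (cong (σ k) ℓ-1) (σkℓ))
                         (trans (cong (σ (k ℤ.+ 1ℤ)) ℓ′) (σk′ℓ)))
            (cong (ℤ._* σ k ℓ) (trans (cong (σ (k ℤ.+ 1ℤ)) ℓ-1′) (σk′ℓ′))))
        unimodular″ : 1ℤ ≡ X ℤ.* Y ℤ.- Z ℤ.* continuant k (3 ℕ.+ t)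
        unimodular″ = sym (continuant-unimodular k (suc t))

      σ≡continuant : ∀ t k → t ≤ N → σ k (k ℤ.+ + t) ≡ continuant k t
      σ≡continuant 0 k _ = trans (cong (σ k) (ℤ.+-identityʳ k)) (row0 k)
      σ≡continuant 1 k _ = row1 k
      σ≡continuant 2 k _ = trans (row2 k) (unit (+ quiddity T (k ℤ.+ 1ℤ)))
        where
        unit : ∀ c → c ≡ c ℤ.* 1ℤ ℤ.- 0ℤ
        unit = ℤ.solve-∀
      σ≡continuant (suc (suc (suc t))) k 3+t≤N = σ-step t k 3+t≤N
        (σ≡continuant (suc (suc t)) k 2+t≤N) (σ≡continuant (suc (suc t)) (k ℤ.+ 1ℤ) 2+t≤N)
        (σ≡continuant (suc t) (k ℤ.+ 1ℤ) (≤-trans (n≤1+n _) 2+t≤N))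
        where 2+t≤N = ≤-trans (n≤1+n _) 3+t≤N

      σ-one : ∀ k {t} → 2 ≤ t → t < N → ind (σ k (k ℤ.+ + t) ℤ.≟ 1ℤ) ≡ δ (v k) (v (k ℤ.+ + t))
      σ-one k {t} 2≤t t<N = begin
        ind (σ k (k ℤ.+ + t) ℤ.≟ 1ℤ)        ≡⟨ cong (λ z → ind (z ℤ.≟ 1ℤ)) (σ≡continuant t k (<⇒≤ t<N)) ⟩
        ind (continuant k t ℤ.≟ 1ℤ)          ≡⟨ AtBase.ind-one k 2≤N refl refl 2≤t t<N ⟩
        Window.e (windowAt k) 0 t             ≡⟨ δ-at k 0 t ⟩
        δ (v (k ℤ.+ + 0)) (v (k ℤ.+ + t))    ≡⟨ cong (λ u → δ (v u) (v (k ℤ.+ + t))) (ℤ.+-identityʳ k) ⟩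
        δ (v k) (v (k ℤ.+ + t))               ∎
        where open ≡-Reasoning

      module _ (i : ℤ) where
        open Window (windowAt i)
        open Triangles (windowAt i)

        -- At distance N the frieze entry is 1 although v_x v_y is a polygon side; therefore y < x +
        -- N.
        σ-e : ∀ {x y} → suc x < y → y < x ℕ.+ N →
          ind (σ (i ℤ.+ + x) (i ℤ.+ + y) ℤ.≟ 1ℤ) ≡ e x y
        σ-e {x} {y} 1+x<y y<x+N with t , refl ← m≤n⇒∃[o]m+o≡n (<⇒≤ (<-trans (n<1+n x) 1+x<y)) =
          trans (subst (λ u → ind (σ (i ℤ.+ + x) u ℤ.≟ 1ℤ) ≡ δ (v (i ℤ.+ + x)) (v u)) (ℤ.+-assoc i (+ x) (+ t))
              (σ-one (i ℤ.+ + x) (+-cancelˡ-≤ x 2 t (subst (_≤ x ℕ.+ t) (+-comm 2 x) 1+x<y)) (+-cancelˡ-< x t N y<x+N)))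
            (sym (δ-at i x (x ℕ.+ t)))

        far? : ∀ k x y → Dec (k ℤ.+ + x ℤ.+ + 2 ℤ.≤ k ℤ.+ + y × σ (k ℤ.+ + x) (k ℤ.+ + y) ≡ 1ℤ)
        far? k x y = k ℤ.+ + x ℤ.+ + 2 ℤ.≤? k ℤ.+ + y ×-dec σ (k ℤ.+ + x) (k ℤ.+ + y) ℤ.≟ 1ℤ

        far⇒< : ∀ k {x y} → k ℤ.+ + x ℤ.+ + 2 ℤ.≤ k ℤ.+ + y → suc x < y
        far⇒< k {x} {y} le = subst (_≤ y) (+-comm x 2)
          (+-cancelˡ-+≤+ k (subst (ℤ._≤ k ℤ.+ + y) (ℤ.+-assoc k (+ x) (+ 2)) le))

        <⇒far : ∀ k {x y} → suc x < y → k ℤ.+ + x ℤ.+ + 2 ℤ.≤ k ℤ.+ + y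
        <⇒far k {x} {y} 1+x<y = subst (ℤ._≤ k ℤ.+ + y) (sym (ℤ.+-assoc k (+ x) (+ 2)))
          (ℤ.+-monoʳ-≤ k (ℤ.+≤+ (subst (_≤ y) (+-comm 2 x) 1+x<y)))

        ind-near : ∀ k {x y} → y ≤ suc x → ind (far? k x y) ≡ 0
        ind-near k y≤1+x = ind-no (far? k _ _) λ { (le , _) → <⇒≱ (far⇒< k le) y≤1+x }

        ind-far : ∀ k {x y} → suc x < y → ind (far? k x y) ≡ ind (σ (k ℤ.+ + x) (k ℤ.+ + y) ℤ.≟ 1ℤ)
        ind-far k 1+x<y = ind-cong (far? k _ _) (σ _ _ ℤ.≟ 1ℤ) proj₂ (<⇒far k 1+x<y ,_)

        νtri-triangle : ∀ {k ℓ lo hi} → hi ≤ suc N → hi ≤ lo ℕ.+ N → Spans i k ℓ lo hi →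
          νtri σ k ℓ ≡ triangle lo hi
        νtri-triangle {lo = lo} {hi} hi≤1+N hi≤lo+N span =
          trans (length-filter-rectangle _ span span) (∑-cong row)
          where
          row : ∀ {x} → lo ≤ x → x < hi → ∑ lo hi (λ y → ind (far? i x y)) ≡ ∑ (suc x) hi (e x)
          row {x} lo≤x x<hi = trans (∑-split _ (m≤n⇒m≤1+n lo≤x) x<hi)
            (cong₂ ℕ._+_ (∑-zero λ _ y<1+x → ind-near i (<⇒≤ y<1+x)) (∑-cong entry))
            where
            entry : ∀ {y} → suc x ≤ y → y < hi → ind (far? i x y) ≡ e x y
            entry {y} 1+x≤y y<hi with m≤n⇒m<n∨m≡n 1+x≤y
            ... | inj₁ 1+x<y = trans (ind-far i 1+x<y) (σ-e 1+x<y (<-≤-trans y<hi (≤-trans hi≤lo+N (+-monoˡ-≤ N lo≤x))))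
            ... | inj₂ refl  = trans (ind-near i ≤-refl) (sym (e-side (s≤s⁻¹ (≤-trans y<hi hi≤1+N))))

        νrec-∑ : ∀ {k u ℓ lo g hi} → hi ≤ lo ℕ.+ N → Spans i k u lo g → Spans i (u ℤ.+ + 2) ℓ (suc g) hi →
          νrec σ k u ℓ ≡ ∑ lo g (λ x → ∑ (suc g) hi (e x))
        νrec-∑ {lo = lo} {g} {hi} hi≤lo+N span span′ = trans (length-filter-rectangle _ span span′)
          (∑-cong λ lo≤x x<g → ∑-cong λ g<y y<hi →
            σ-e (<-≤-trans (s≤s x<g) g<y) (<-≤-trans y<hi (≤-trans hi≤lo+N (+-monoˡ-≤ N lo≤x))))

        -- v_{i-1} and v_{i+N} are the same vertex, so row i - 1 of the frieze records the diagonals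
        -- to the last vertex. It starts at b = i + 1; the term of `fan` missing at v_i is the base
        -- edge and vanishes.
        νmd-fan : ∀ ℓ {g} → g < N → ℓ ℤ.+ 1ℤ ≡ i ℤ.+ + g → νmd σ (i ℤ.- 1ℤ) ℓ ≡ fan g
        νmd-fan ℓ {g} g<N ℓ+1≡ = trans
          (length-filter-range (λ b → σ (i ℤ.- 1ℤ) b ℤ.≟ 1ℤ) span)
          (trans (∑-cong entry) (from-one g))
          where
          i-1+1 : ∀ i x → i ℤ.- 1ℤ ℤ.+ (1ℤ ℤ.+ x) ≡ i ℤ.+ x
          i-1+1 = ℤ.solve-∀
          span : Spans i (i ℤ.- 1ℤ ℤ.+ + 2) ℓ 1 g
          span = spans (i-1+1 i 1ℤ) ℓ+1≡
          i-1+n : v {n} (i ℤ.- 1ℤ) ≡ v (i ℤ.+ + N)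
          i-1+n = begin
            v k                       ≡⟨ cong v (ℤ.+-identityʳ k) ⟨
            v (k ℤ.+ + 0)             ≡⟨ at k 0 ⟩
            V (residue k ℕ.+ 0)       ≡⟨ V-+n (residue k ℕ.+ 0) ⟨
            V (n ℕ.+ (residue k ℕ.+ 0)) ≡⟨ cong V (trans (+-comm n _) (cong (ℕ._+ n) (+-identityʳ (residue k)))) ⟩
            V (residue k ℕ.+ n)       ≡⟨ at k n ⟨
            v (k ℤ.+ + n)             ≡⟨ cong v (i-1+1 i (+ N)) ⟩
            v (i ℤ.+ + N)             ∎
            where
            open ≡-Reasoning
            k = i ℤ.- 1ℤ
          entry : ∀ {y} → 1 ≤ y → y < g → ind (σ (i ℤ.- 1ℤ) (i ℤ.+ + y) ℤ.≟ 1ℤ) ≡ e y N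
          entry {y} 1≤y y<g = begin
            ind (σ k (i ℤ.+ + y) ℤ.≟ 1ℤ)          ≡⟨ cong (λ u → ind (σ k u ℤ.≟ 1ℤ)) (i-1+1 i (+ y)) ⟨
            ind (σ k (k ℤ.+ + suc y) ℤ.≟ 1ℤ)      ≡⟨ σ-one k (s≤s 1≤y) (≤-<-trans y<g g<N) ⟩
            δ (v k) (v (k ℤ.+ + suc y))           ≡⟨ cong₂ δ i-1+n (cong v (i-1+1 i (+ y))) ⟩
            δ (v (i ℤ.+ + N)) (v (i ℤ.+ + y))     ≡⟨ δ-sym _ _ ⟩
            δ (v (i ℤ.+ + y)) (v (i ℤ.+ + N))     ≡⟨ δ-at i y N ⟨
            e y N                                  ∎
            where
            open ≡-Reasoning
            k = i ℤ.- 1ℤ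
          from-one : ∀ g → ∑ 1 g (λ y → e y N) ≡ fan g
          from-one zero    = trans (∑-def 1 0 _) (sym (∑-empty 0 _))
          from-one (suc g) = sym (trans (∑-first _ (s≤s z≤n)) (cong (ℕ._+ ∑ 1 (suc g) (λ y → e y N)) e-base))

        νtri-first-row : ∀ ℓ g → ℓ ℤ.+ 1ℤ ≡ i ℤ.+ + g →
          νtri σ (i ℤ.- 1ℤ) ℓ ≡ νmd σ (i ℤ.- 1ℤ) ℓ ℕ.+ νtri σ i ℓ
        νtri-first-row ℓ g ℓ+1≡ = begin
          νtri σ k ℓ
            ≡⟨ length-filter-rectangle _ span₀ span₀ ⟩
          ∑ 0 (suc g) (λ x → ∑ 0 (suc g) (h x))
            ≡⟨ ∑-first _ (s≤s z≤n) ⟩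
          ∑ 0 (suc g) (h 0) ℕ.+ ∑ 1 (suc g) (λ x → ∑ 0 (suc g) (h x))
            ≡⟨ cong₂ ℕ._+_ (first-row g) (∑-cong λ _ _ →
                 trans (∑-first _ (s≤s z≤n)) (cong (ℕ._+ ∑ 1 (suc g) (h _)) (ind-near k z≤n))) ⟩
          ∑ 2 (suc g) (λ y → ind (σ k (k ℤ.+ + y) ℤ.≟ 1ℤ)) ℕ.+ ∑ 1 (suc g) (λ x → ∑ 1 (suc g) (h x))
            ≡⟨ cong₂ ℕ._+_ (length-filter-range (λ b → σ k b ℤ.≟ 1ℤ) span₂) (length-filter-rectangle _ span₁ span₁) ⟨
          νmd σ k ℓ ℕ.+ νtri σ i ℓ ∎
          where
          open ≡-Reasoning
          k = i ℤ.- 1ℤ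
          h : ℕ → ℕ → ℕ
          h x y = ind (far? k x y)
          i-1+1 : ∀ i x → i ℤ.+ x ≡ i ℤ.- 1ℤ ℤ.+ (1ℤ ℤ.+ x)
          i-1+1 = ℤ.solve-∀
          end : ℓ ℤ.+ 1ℤ ≡ k ℤ.+ + suc g
          end = trans ℓ+1≡ (i-1+1 i (+ g))
          span₀ : Spans k k ℓ 0 (suc g)
          span₀ = spans (sym (ℤ.+-identityʳ k)) end
          span₁ : Spans k i ℓ 1 (suc g)
          span₁ = spans (trans (sym (ℤ.+-identityʳ i)) (i-1+1 i 0ℤ)) end
          span₂ : Spans k (k ℤ.+ + 2) ℓ 2 (suc g)
          span₂ = spans refl end
          first-row : ∀ g → ∑ 0 (suc g) (h 0) ≡ ∑ 2 (suc g) (λ y → ind (σ k (k ℤ.+ + y) ℤ.≟ 1ℤ))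
          first-row zero    = trans (∑-single 0 (h 0)) (trans (ind-near k z≤n) (sym (∑-def 2 1 _)))
          first-row (suc g) = trans (∑-split (h 0) z≤n (s≤s (s≤s z≤n)))
            (cong₂ ℕ._+_ (∑-zero λ _ y<2 → ind-near k (s≤s⁻¹ y<2))
              (∑-cong λ 2≤y _ → trans (ind-far k 2≤y) (cong (λ u → ind (σ u (k ℤ.+ + _) ℤ.≟ 1ℤ)) (ℤ.+-identityʳ k))))

-- The degree formulas for numerators and denominators

open import Data.Integer using (ℤ; +_; 1ℤ; _+_; _-_; _≤_)
open Sums using (∑)
open Windows using (Window)
open Ranges
open Labels
open FriezeEntries

module LabelDegrees (N : ℕ) (2≤N : 2 ℕ.≤ N) (T : Triangulation (suc N)) (F : Frieze T)
              (i : ℤ) (L : FareyLabeling T i) where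
  open Friezes N 2≤N T
  open Frieze F
  open FareyLabeling L
  open Window (windowAt i)
  open Triangles (windowAt i)

  private
    n = suc N

  last≡ : last ≡ i + + N
  last≡ = ℤ.+-assoc i (+ n) (ℤ.- 1ℤ)

  i+0≡ : i + + 0 ≡ i
  i+0≡ = ℤ.+-identityʳ i

  edge : ∀ {x y} → E x y → Edge T (v (i + + x)) (v (i + + y))
  edge = subst₂ (Edge T) (sym (at i _)) (sym (at i _))

  open Degrees.Extremal (windowAt i) 2≤N (λ x → r (i + + x)) (λ x → s (i + + x)) (λ x y → w (i + + x) (i + + y))
    (trans (cong₂ w i+0≡ (sym last≡)) w-base)
    (subst (λ u → r u ≈ 0ᵖ) last≡ r-last) (subst (λ u → s u ≈ 1ᵖ) last≡ s-last)
    (subst (λ u → r u ≈ 1ᵖ) (sym i+0≡) r-first) (subst (λ u → s u ≈ 0ᵖ) (sym i+0≡) s-first)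
    (λ {b} {g} {a} ℓ b<g g<a a≤N bg ga ba → cellRule (ℤ.i≤i+j i (+ b))
      (ℤ.+-monoʳ-< i (ℤ.+<+ b<g)) (ℤ.+-monoʳ-< i (ℤ.+<+ g<a))
      (subst (i + + a ≤_) (sym last≡) (ℤ.+-monoʳ-≤ i (ℤ.+≤+ a≤N)))
      (edge bg , edge ga , edge ba))
  open Extremes

  sum-degrees : ∀ {k ℓ lo hi} → Spans i k ℓ lo hi →
    sumFromTo k ℓ (λ u → + quiddity T u - 1ℤ) ≡ + ∑ lo hi (λ x → ∑ 0 n (e x))
  sum-degrees span = sumFromTo-∑ _ _ span λ t →
    cong (λ c → + c - 1ℤ) (quiddity-chords i t)

  solve-degree : ∀ {S d a b a′ b′} → S ≡ + (a′ ℕ.+ b′ ℕ.+ d) → a ≡ a′ → b ≡ b′ → + d ≡ S - + a - + b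
  solve-degree {d = d} {a} {b} refl refl refl = cancel (+ a) (+ b) (+ d)
    where
    cancel : ∀ a b d → d ≡ a + b + d - a - b
    cancel = ℤ.solve-∀

  module _ (j : ℤ) {g : ℕ} (j+1≡ : j + 1ℤ ≡ i + + g) where

    private
      span : Spans i i j 0 g
      span = spans (sym i+0≡) j+1≡

      span₁ : Spans i (i + 1ℤ) j 1 g
      span₁ = spans refl j+1≡

      j+2≡ : j + + 2 ≡ i + + suc g
      j+2≡ = trans (sym (ℤ.+-assoc j 1ℤ 1ℤ))
        (trans (cong (_+ 1ℤ) j+1≡)
          (trans (ℤ.+-assoc i (+ g) 1ℤ) (cong (λ z → i + + z) (ℕ.+-comm g 1))))

      j+1+1≡ : j + 1ℤ + 1ℤ ≡ i + + suc g
      j+1+1≡ = trans (ℤ.+-assoc j 1ℤ 1ℤ) j+2≡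

      span⁺ : Spans i i (j + 1ℤ) 0 (suc g)
      span⁺ = spans (sym i+0≡) j+1+1≡

      span₁⁺ : Spans i (i + 1ℤ) (j + 1ℤ) 1 (suc g)
      span₁⁺ = spans refl j+1+1≡

    numerator : g ℕ.< N →
        (∃[ d ] IsDegMin (r (j + 1ℤ)) d
              × + d ≡ + νtri σ (i - 1ℤ) j - + νtri σ i j
              × d ≡ νmd σ (i - 1ℤ) j)
      × (∃[ d ] IsDeg (r (j + 1ℤ)) d
              × + d ≡ sumFromTo i j (λ u → + quiddity T u - 1ℤ) - + νtri σ i (j + 1ℤ) - + νtri σ i j
              × d ≡ νmd σ (i - 1ℤ) j ℕ.+ νrec σ i j (i + + n - + 2))
    numerator g<N =
      (fan g , subst (λ u → IsDegMin (r u) (fan g)) (sym j+1≡) (Bot⇒IsDegMin (r (i + + g)) (r-bot ext g<N))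
        , fan-difference , sym md≡)
      , (over 0 g , subst (λ u → IsDeg (r u) (over 0 g)) (sym j+1≡) (Top⇒IsDeg (r (i + + g)) (r-top ext g<N))
        , solve-degree (trans (sum-degrees span) (cong +_ (degrees 0 z≤n g≤N)))
            (νtri-triangle F i (ℕ.≤-trans g<N (ℕ.n≤1+n N)) g<N span⁺)
            (νtri-triangle F i (ℕ.m≤n⇒m≤1+n g≤N) g≤N span)
        , trans (over-fan g<N) (cong₂ ℕ._+_ (sym md≡)
            (sym (νrec-∑ F i ℕ.≤-refl span beyond))))
      where
      g≤N = ℕ.<⇒≤ g<N
      ext = extremes g g≤N
      md≡ : νmd σ (i - 1ℤ) j ≡ fan g
      md≡ = νmd-fan F i j g<N j+1≡
      fan-difference : + fan g ≡ + νtri σ (i - 1ℤ) j - + νtri σ i j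
      fan-difference = trans (cong +_ (sym md≡)) (trans (cancel (+ νmd σ (i - 1ℤ) j) (+ νtri σ i j))
        (cong (λ z → + z - + νtri σ i j) (sym (νtri-first-row F i j g j+1≡))))
        where
        cancel : ∀ x y → x ≡ x + y - y
        cancel = ℤ.solve-∀
      -- The range stops one vertex before the last, since the diagonals to v_{i+n-1} are already
      -- counted by `νmd`.
      beyond : Spans i (j + + 2) (i + + n - + 2) (suc g) N
      beyond = spans j+2≡ (shift i (+ N))
        where
        shift : ∀ i x → i + (1ℤ + x) - (1ℤ + 1ℤ) + 1ℤ ≡ i + x
        shift = ℤ.solve-∀

    denominator : 1 ℕ.≤ g → g ℕ.≤ N →
        IsDegMin (s (j + 1ℤ)) 0
      × (∃[ d ] IsDeg (s (j + 1ℤ)) d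
              × + d ≡ sumFromTo (i + 1ℤ) j (λ u → + quiddity T u - 1ℤ) - + νtri σ (i + 1ℤ) (j + 1ℤ) - + νtri σ i j
              × d ≡ νrec σ (i + 1ℤ) j (i + + n - 1ℤ))
    denominator 1≤g g≤N =
      subst (λ u → IsDegMin (s u) 0) (sym j+1≡) (Bot⇒IsDegMin (s (i + + g)) (s-bot ext 1≤g))
      , (over 1 g , subst (λ u → IsDeg (s u) (over 1 g)) (sym j+1≡) (Top⇒IsDeg (s (i + + g)) (s-top ext 1≤g))
        , solve-degree (trans (sum-degrees span₁) (cong +_ (degrees₁ 1≤g g≤N)))
            (νtri-triangle F i (s≤s g≤N) (s≤s g≤N) span₁⁺)
            (νtri-triangle F i (ℕ.m≤n⇒m≤1+n g≤N) g≤N span)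
        , sym (νrec-∑ F i ℕ.≤-refl span₁ beyond))
      where
      ext = extremes g g≤N
      beyond : Spans i (j + + 2) (i + + n - 1ℤ) (suc g) n
      beyond = spans j+2≡ (shift i (+ n))
        where
        shift : ∀ i x → i + x - 1ℤ + 1ℤ ≡ i + x
        shift = ℤ.solve-∀

proposition4p4 : (n : ℕ) .{{_ : NonZero n}} → 3 ℕ.≤ n →
    (T : Triangulation n) (F : Frieze T) (i : ℤ) (L : FareyLabeling T i) →
    let open Frieze F
        open FareyLabeling L
        c = quiddity T
    in
      ( (∀ (j : ℤ) → i - 1ℤ ≤ j → j ≤ i + + n - + 3 →
           (∃[ d ] IsDegMin (r (j + 1ℤ)) d
                 × + d ≡ + νtri σ (i - 1ℤ) j - + νtri σ i j
                 × d ≡ νmd σ (i - 1ℤ) j)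
         × (∃[ d ] IsDeg (r (j + 1ℤ)) d
                 × + d ≡ sumFromTo i j (λ u → + c u - 1ℤ) - + νtri σ i (j + 1ℤ) - + νtri σ i j
                 × d ≡ νmd σ (i - 1ℤ) j ℕ.+ νrec σ i j (i + + n - + 2)))
      × r (i + + n - 1ℤ) ≈ 0ᵖ )
    × ( (∀ (j : ℤ) → i ≤ j → j ≤ i + + n - + 2 →
           IsDegMin (s (j + 1ℤ)) 0
         × (∃[ d ] IsDeg (s (j + 1ℤ)) d
                 × + d ≡ sumFromTo (i + 1ℤ) j (λ u → + c u - 1ℤ) - + νtri σ (i + 1ℤ) (j + 1ℤ) - + νtri σ i j
                 × d ≡ νrec σ (i + 1ℤ) j (i + + n - 1ℤ)))
      × s i ≈ 0ᵖ )
proposition4p4 (suc N) (s≤s 2≤N) T F i L =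
  (numerators , r-last) , (denominators , s-first)
  where
  open FareyLabeling L
  open LabelDegrees N 2≤N T F i L

  numerators = λ j i-1≤j j≤ →
    -- Counting from i - 1 puts v_{j+1} at position g, so g = 0 is the vertex v_i.
    let g , j≡ = offset i-1≤j
    in numerator j (trans (cong (_+ 1ℤ) j≡) (up i (+ g)))
         (+-cancelˡ-+≤+ (i - 1ℤ) {suc g} {N}
           (subst₂ _≤_ (trans (cong (_+ 1ℤ) j≡) (up′ i (+ g))) (bound i (+ N)) (ℤ.+-monoˡ-≤ 1ℤ j≤)))
    where
    up : ∀ i x → i - 1ℤ + x + 1ℤ ≡ i + x
    up = ℤ.solve-∀
    up′ : ∀ i x → i - 1ℤ + x + 1ℤ ≡ i - 1ℤ + (1ℤ + x)
    up′ = ℤ.solve-∀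
    bound : ∀ i x → i + (1ℤ + x) - (1ℤ + 1ℤ + 1ℤ) + 1ℤ ≡ i - 1ℤ + x
    bound = ℤ.solve-∀

  denominators = λ j i≤j j≤ →
    -- Counting from i puts v_{j+1} at position g + 1, away from the vanishing denominator at v_i.
    let g , j≡ = offset i≤j
    in denominator j (trans (cong (_+ 1ℤ) j≡) (up i (+ g))) (s≤s z≤n)
         (+-cancelˡ-+≤+ i {suc g} {N}
           (subst₂ _≤_ (trans (cong (_+ 1ℤ) j≡) (up i (+ g))) (bound i (+ N)) (ℤ.+-monoˡ-≤ 1ℤ j≤)))
    where
    up : ∀ i x → i + x + 1ℤ ≡ i + (1ℤ + x)
    up = ℤ.solve-∀
    bound : ∀ i x → i + (1ℤ + x) - (1ℤ + 1ℤ) + 1ℤ ≡ i + x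
    bound = ℤ.solve-∀
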